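{- Let $G$ be a Berge graph, let $X\subseteq V(G)$ be nonempty and anticonnected, and let $P$ be a path or hole in $G\setminus X$ having at least three $X$-complete vertices. If $Q$ is a subpath of $P$ whose two ends are $X$-complete, then the number of $X$-complete edges of $Q$ has the same parity as the length of $Q$. Consequently, for every hole $C$ of $G\setminus X$, either $C$ has an even number of $X$-complete edges, or $C$ has exactly two $X$-complete vertices and they are adjacent.
   Context: Graphs are finite and simple. Hole: induced cycle of length $\ge 4$; antihole: induced subgraph whose complement is a hole; $G$ is Berge if all holes and antiholes have even length. A path means an induced subgraph that is a path; its length is its number of edges. $X$ is anticonnected if the complement of $G|X$ is connected. A vertex is $X$-complete if adjacent to all of $X$; an edge is $X$-complete if both ends are. -}

module Defs where

open import Data.Fin.Base using (Fin; toℕ)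
open import Data.Fin.Properties using (all?) renaming (_≟_ to _≟ᶠ_)
open import Data.Fin.Subset using (Subset; _∈_; _∉_; ∣_∣)
open import Data.Fin.Subset.Properties using (_∈?_)
open import Data.Nat.Base using (ℕ; suc; _≤_; parity)
open import Data.Nat.Properties using (_<?_)
open import Data.Parity.Base using (0ℙ)
open import Data.Product.Base using (_×_; _,_; ∃)
open import Data.Sum.Base using (_⊎_)
open import Data.Vec.Base using (tabulate; sum)
open import Function.Base using (_∘_)
open import Function.Bundles using (_⇔_)
open import Function.Definitions using (Injective)
open import Level using (0ℓ)
open import Relation.Binary.Core using (Rel)
import Relation.Binary.Definitions as B
open import Relation.Binary.Construct.Closure.ReflexiveTransitive using (Star)
open import Relation.Binary.PropositionalEquality using (_≡_; _≢_; sym)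
open import Relation.Nullary using (¬_; does; contradiction)
open import Relation.Nullary.Decidable using (¬?; _×-dec_; _→-dec_)
open import Relation.Unary using (Pred; Decidable)

record Graph (n : ℕ) : Set₁ where
  field
    Adj    : Rel (Fin n) 0ℓ
    adj?   : B.Decidable Adj
    symm   : B.Symmetric Adj
    irrefl : B.Irreflexive _≡_ Adj

open Graph public

Even : ℕ → Set
Even k = parity k ≡ 0ℙ

count : ∀ {m} {P : Pred (Fin m) 0ℓ} → Decidable P → ℕ
count P? = ∣ tabulate (does ∘ P?) ∣

module _ {n : ℕ} where

  complement : Graph n → Graph n
  complement G = record
    { Adj    = λ u v → u ≢ v × ¬ Adj G u v
    ; adj?   = λ u v → ¬? (u ≟ᶠ v) ×-dec ¬? (adj? G u v)
    ; symm   = λ (u≢v , ¬uv) → u≢v ∘ sym , ¬uv ∘ symm G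
    ; irrefl = λ u≡v (u≢v , _) → contradiction u≡v u≢v
    }

  -- G|X is connected: any two vertices of X are joined by a walk inside X.
  ConnectedOn : Graph n → Subset n → Set
  ConnectedOn G X = ∀ {u v} → u ∈ X → v ∈ X →
    Star (λ a b → a ∈ X × b ∈ X × Adj G a b) u v

  -- Restricting to X commutes with complementation.
  Anticonnected : Graph n → Subset n → Set
  Anticonnected G = ConnectedOn (complement G)

-- Paths and holes are induced subgraphs, given by listing their vertices in
-- order: f : Fin m → Fin n enumerates m distinct vertices, and the subgraph
-- they induce is carried by the pattern R on positions 0, …, m - 1.

Induces : ∀ {n m} → Graph n → Rel (Fin m) 0ℓ → (Fin m → Fin n) → Set
Induces G R f =
  Injective _≡_ _≡_ f × (∀ i j → R i j ⇔ Adj G (f i) (f j))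

PathAdj : ∀ {m} → Rel (Fin m) 0ℓ
PathAdj i j = suc (toℕ i) ≡ toℕ j ⊎ suc (toℕ j) ≡ toℕ i

LastFirst : ∀ {m} → Rel (Fin m) 0ℓ
LastFirst {m} i j = suc (toℕ i) ≡ m × toℕ j ≡ 0

-- The cycle on m positions; meaningful for m ≥ 3 only.
CycleAdj : ∀ {m} → Rel (Fin m) 0ℓ
CycleAdj i j = PathAdj i j ⊎ LastFirst i j ⊎ LastFirst j i

module _ {n : ℕ} (G : Graph n) where

  -- A path on m vertices has length m - 1.
  IsPath : ∀ {m} → (Fin m → Fin n) → Set
  IsPath {m} p = 1 ≤ m × Induces G PathAdj p

  -- A hole on m vertices has length m.
  IsHole : ∀ {m} → (Fin m → Fin n) → Set
  IsHole {m} c = 4 ≤ m × Induces G CycleAdj c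

-- The length of an antihole is that of the hole in the complement.
IsAntihole : ∀ {n m} → Graph n → (Fin m → Fin n) → Set
IsAntihole G = IsHole (complement G)

Berge : ∀ {n} → Graph n → Set
Berge {n} G =
  (∀ {m} (c : Fin m → Fin n) → IsHole G c → Even m) ×
  (∀ {m} (c : Fin m → Fin n) → IsAntihole G c → Even m)

_Avoids_ : ∀ {n m} → (Fin m → Fin n) → Subset n → Set
f Avoids X = ∀ i → f i ∉ X

-- For q and p both induced in G, a path q with V(q) ⊆ V(p) is the same thing
-- as a path of the graph p.
_⊑_ : ∀ {n l m} → (Fin l → Fin n) → (Fin m → Fin n) → Set
q ⊑ p = ∀ i → ∃ λ j → q i ≡ p j

module _ {n : ℕ} (G : Graph n) (X : Subset n) where

  Complete : Pred (Fin n) 0ℓ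
  Complete v = ∀ x → x ∈ X → Adj G v x

  complete? : Decidable Complete
  complete? v = all? λ x → (x ∈? X) →-dec adj? G v x

  #completeVertices : ∀ {m} → (Fin m → Fin n) → ℕ
  #completeVertices f = count (λ i → complete? (f i))

  CompleteEdge : Rel (Fin n) 0ℓ
  CompleteEdge u v = Adj G u v × Complete u × Complete v

  completeEdge? : B.Decidable CompleteEdge
  completeEdge? u v = adj? G u v ×-dec complete? u ×-dec complete? v

  -- Edges of the subgraph induced on the vertices f 0, …, f (m - 1); each
  -- unordered pair is counted once, as i < j.
  #completeEdges : ∀ {m} → (Fin m → Fin n) → ℕ
  #completeEdges f = sum (tabulate λ i →
    count (λ j → (toℕ i <? toℕ j) ×-dec completeEdge? (f i) (f j)))

module Submission where

-- It suffices to show that a path p whose ends are the only X-complete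
-- vertices on it has length 1 or even length as soon as there is a further
-- X-complete vertex v with no neighbour in its interior.  For the hole or path
-- of the theorem, a third X-complete vertex serves as v, since an interior
-- vertex of p has both its neighbours on p.
--
-- Induct on |X|, with H the complement of G.  If X is a clique of H, count the
-- edges of p with a common neighbour in Y ⊆ X: by holes through one or two
-- vertices of Y (and v) their number has the parity of p for every nonempty Y,
-- and inclusion–exclusion transfers this to the X-complete edges.  Otherwise X
-- has vertices u, w joined by an induced path R of H, of length k ≥ 2, such
-- that U = X - u, W = X - w, and for odd k also Z = X - u - w, are connected
-- in H.  Let p have odd length greater than 1.  By induction p has an odd
-- number of U-complete and of W-complete edges.
--   k even: R and two nonadjacent inner vertices, one U-complete and one
-- W-complete, would form an odd antihole.  Such vertices being adjacent, p has
-- length 3 and its four vertices together with R form an odd antihole.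
--   k odd: odd antiholes through v show that these vertices are never adjacent
-- and that each inner Z-complete vertex is U- or W-complete.  So the number of
-- Z-complete edges, which is odd, is the sum of two odd numbers.

open import Defs
open import Data.Bool.Base using (true; false; _∧_; _∨_; if_then_else_)
open import Data.Empty using (⊥; ⊥-elim)
open import Data.Fin.Base using (Fin; zero; suc; toℕ; fromℕ)
open import Data.Fin.Properties
  using (toℕ-injective; toℕ<n; toℕ-fromℕ<; toℕ-fromℕ)
  renaming (_≟_ to _≟ᶠ_; suc-injective to suc-injectiveᶠ)
open import Data.Fin.Subset using (Subset; Nonempty; inside; outside; ∣_∣; _-_)
  renaming (_∈_ to _∈ˢ_; _∉_ to _∉ˢ_)
open import Data.Fin.Subset.Properties
  using (_∈?_; nonempty?; Empty-unique; ∣⊥∣≡0; p─q⊆p; drop-there; p⊆q⇒∣p∣≤∣q∣;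
         ∣p∣≤∣x∷p∣; x∈p⇒∣p-x∣<∣p∣; x∈p∧x≢y⇒x∈p-y)
open import Data.List.Base using (List; []; _∷_; [_]; length; filter; allFin)
import Data.List.Membership.DecPropositional as DecMembership
open import Data.List.Membership.Propositional using (_∈_; _∉_; lose; find)
open import Data.List.Membership.Propositional.Properties
  using (∈-filter⁺; ∈-filter⁻; ∈-allFin)
open import Data.List.Properties using (filter-notAll)
open import Data.List.Relation.Binary.Subset.Propositional using (_⊆_)
open import Data.List.Relation.Binary.Subset.Propositional.Properties using (∷⁺ʳ)
open import Data.List.Relation.Unary.All as All using (All; []; _∷_; all?)
open import Data.List.Relation.Unary.All.Properties using (¬All⇒Any¬)
open import Data.List.Relation.Unary.AllPairs using (AllPairs; []; _∷_)
import Data.List.Relation.Unary.AllPairs.Properties as AllPairs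
open import Data.List.Relation.Unary.Any as Any using (Any; here; there; any?)
open import Data.Nat.Base hiding (∣_-_∣)
open import Data.Nat.Divisibility using (_∣_; ∣m+n∣m⇒∣n; n∣m*n; >⇒∤)
open import Data.Nat.DivMod
open import Data.Nat.Induction using (<-wellFounded)
open import Data.Nat.Properties
open import Algebra.Properties.CommutativeSemigroup +-commutativeSemigroup
  using (interchange)
open import Data.Parity.Base as ℙ using (0ℙ)
open import Data.Parity.Properties as ℙ using (+-homo-+) renaming (_≟_ to _≟ᵖ_)
open import Data.Product.Base using (_×_; _,_; proj₁; proj₂; ∃; ∃₂)
open import Data.Sum.Base as Sum using (_⊎_; inj₁; inj₂; [_,_]′)
open import Data.Vec.Base using (tabulate; sum; []; _∷_; here; there)
open import Data.Vec.Properties using (lookup⇒[]=; []=⇒lookup; lookup∘tabulate)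
open import Function.Base using (_∘_; _$_; const; id)
open import Function.Bundles using (mk⇔; Equivalence)
open import Induction.WellFounded using (Acc; acc)
open import Level using (0ℓ)
open import Relation.Binary.Construct.Closure.ReflexiveTransitive using (Star; ε; _◅_)
open import Relation.Binary.Definitions using (tri<; tri≈; tri>)
open import Relation.Binary.PropositionalEquality hiding ([_])
open import Relation.Nullary using (¬_; Dec; yes; no; does; contradiction)
open import Relation.Nullary.Decidable using (¬?; _×-dec_; dec-true)
open import Relation.Unary using (Pred; Decidable)

-- Induced paths and holes

-- An induced path of length l, listed by a sequence of which only the terms
-- 0, …, l matter.
record Path {n} (H : Graph n) (p : ℕ → Fin n) (l : ℕ) : Set where
  field
    distinct    : ∀ {i j} → i < j → j ≤ l → p i ≢ p j
    consecutive : ∀ {i} → i < l → Adj H (p i) (p (suc i))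
    chordless   : ∀ {i j} → i < j → j ≤ l → Adj H (p i) (p j) → suc i ≡ j

open Path public

segment : ∀ {A : Set} → ℕ → (ℕ → A) → ℕ → A
segment a p i = p (a + i)

reverse : ∀ {A : Set} → ℕ → (ℕ → A) → ℕ → A
reverse l p i = p (l ∸ i)

infixr 5 _◂_

_◂_ : ∀ {A : Set} → A → (ℕ → A) → ℕ → A
(x ◂ p) zero    = x
(x ◂ p) (suc i) = p i

-- Half of `Berge` for a single graph: for `G` it concerns holes and for `complement G` antiholes,
-- so that one closing lemma serves both.
EvenHoles : ∀ {n} → Graph n → Set
EvenHoles {n} H = ∀ {m} (c : Fin m → Fin n) → IsHole H c → Even m

module _ {n : ℕ} {H : Graph n} where

  adj⇒≢ : ∀ {u v} → Adj H u v → u ≢ v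
  adj⇒≢ uv u≡v = irrefl H u≡v uv

  module _ {p : ℕ → Fin n} {l : ℕ} (P : Path H p l) where

    injective : ∀ {i j} → i ≤ l → j ≤ l → p i ≡ p j → i ≡ j
    injective {i} {j} i≤l j≤l eq with <-cmp i j
    ... | tri< i<j _ _ = contradiction eq (distinct P i<j j≤l)
    ... | tri≈ _ i≡j _ = i≡j
    ... | tri> _ _ j<i = contradiction (sym eq) (distinct P j<i i≤l)

    induced : ∀ {i j} → i ≤ l → j ≤ l → Adj H (p i) (p j) → suc i ≡ j ⊎ suc j ≡ i
    induced {i} {j} i≤l j≤l e with <-cmp i j
    ... | tri< i<j _ _ = inj₁ (chordless P i<j j≤l e)
    ... | tri≈ _ i≡j _ = contradiction (cong p i≡j) (adj⇒≢ e)
    ... | tri> _ _ j<i = inj₂ (chordless P j<i i≤l (symm H e))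

    segment-path : ∀ {a d} → a + d ≤ l → Path H (segment a p) d
    segment-path {a} {d} a+d≤l = record
      { distinct    = λ i<j j≤d → distinct P (+-monoʳ-< a i<j) (bound j≤d)
      ; consecutive = λ {i} i<d →
          subst (Adj H (p (a + i)) ∘ p) (sym (+-suc a i))
            (consecutive P (<-≤-trans (+-monoʳ-< a i<d) a+d≤l))
      ; chordless   = λ {i} i<j j≤d e → +-cancelˡ-≡ a _ _
          (trans (+-suc a i) (chordless P (+-monoʳ-< a i<j) (bound j≤d) e))
      }
      where
      bound : ∀ {j} → j ≤ d → a + j ≤ l
      bound j≤d = ≤-trans (+-monoʳ-≤ a j≤d) a+d≤l

    reverse-path : Path H (reverse l p) l
    reverse-path = record
      { distinct    = λ {i} i<j j≤l eq →
          distinct P (∸-monoʳ-< i<j j≤l) (m∸n≤m l i) (sym eq)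
      ; consecutive = λ {i} i<l →
          subst (λ k → Adj H (p k) (p (l ∸ suc i))) (sym (+-∸-assoc 1 i<l))
            (symm H (consecutive P (≤-trans (≤-reflexive (sym (+-∸-assoc 1 i<l))) (m∸n≤m l i))))
      ; chordless   = λ {i} {j} i<j j≤l e → suc-injective (begin
          suc (suc i)                  ≡⟨ cong 2+ (sym (m∸[m∸n]≡n (≤-trans (<⇒≤ i<j) j≤l))) ⟩
          suc (suc (l ∸ (l ∸ i)))      ≡⟨ cong (λ k → suc (suc (l ∸ k)))
                                            (sym (chordless P (∸-monoʳ-< i<j j≤l) (m∸n≤m l i) (symm H e))) ⟩
          suc (suc (l ∸ suc (l ∸ j)))  ≡⟨ cong suc (sym (+-∸-assoc 1 (small i<j j≤l))) ⟩
          suc (l ∸ (l ∸ j))            ≡⟨ cong suc (m∸[m∸n]≡n j≤l) ⟩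
          suc j                        ∎)
      }
      where
      open ≡-Reasoning
      small : ∀ {i j} → i < j → j ≤ l → l ∸ j < l
      small {i} {suc j} _ j<l = ∸-monoʳ-< (s≤s (z≤n {j})) j<l

    cons-path : ∀ {x} → (∀ {i} → i ≤ l → x ≢ p i) → Adj H x (p 0) →
      (∀ {i} → 0 < i → i ≤ l → ¬ Adj H x (p i)) → Path H (x ◂ p) (suc l)
    cons-path {x} x∉p x~p₀ x≁p = record
      { distinct = λ { {zero} {suc j} _ (s≤s j≤l) → x∉p j≤l
                     ; {suc i} {suc j} (s≤s i<j) (s≤s j≤l) → distinct P i<j j≤l }
      ; consecutive = λ { {zero} _ → x~p₀ ; {suc i} (s≤s i<l) → consecutive P i<l }
      ; chordless = λ { {zero} {suc zero} _ _ _ → refl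
                      ; {zero} {suc (suc j)} _ (s≤s j<l) e → contradiction e (x≁p (s≤s z≤n) j<l)
                      ; {suc i} {suc j} (s≤s i<j) (s≤s j≤l) e → cong suc (chordless P i<j j≤l e) }
      }

    -- The vertex and the path form a hole of length `2+ l`, whose parity reduces to that of `l`.
    path-closed-by-vertex : EvenHoles H → 2 ≤ l → ∀ {w} → (∀ {i} → i ≤ l → w ≢ p i) →
      Adj H w (p 0) → Adj H w (p l) →
      (∀ {i} → 0 < i → i < l → ¬ Adj H w (p i)) → Even l
    path-closed-by-vertex even 2≤l {w} w∉p w~p₀ w~pₗ w≁p =
      even c (s≤s (s≤s 2≤l) , (λ {i} {j} → c-injective i j) , λ i j → mk⇔ (to i j) (from i j))
      where
      c : Fin (suc (suc l)) → Fin n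
      c zero    = w
      c (suc i) = p (toℕ i)

      ≤l : (i : Fin (suc l)) → toℕ i ≤ l
      ≤l i = s≤s⁻¹ (toℕ<n i)

      c-injective : ∀ i j → c i ≡ c j → i ≡ j
      c-injective zero    zero    _  = refl
      c-injective zero    (suc j) eq = contradiction eq (w∉p (≤l j))
      c-injective (suc i) zero    eq = contradiction (sym eq) (w∉p (≤l i))
      c-injective (suc i) (suc j) eq = cong suc (toℕ-injective (injective (≤l i) (≤l j) eq))

      spoke : ∀ {i} → i ≤ l → Adj H w (p i) → i ≡ 0 ⊎ i ≡ l
      spoke {zero} _ _ = inj₁ refl
      spoke {suc i} i<l e with m≤n⇒m<n∨m≡n i<l
      ... | inj₁ i<l′ = contradiction e (w≁p (s≤s z≤n) i<l′)
      ... | inj₂ i≡l  = inj₂ i≡l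

      path⇒adj : ∀ {i j} → j ≤ l → suc i ≡ j → Adj H (p i) (p j)
      path⇒adj j≤l refl = consecutive P j≤l

      to : ∀ i j → CycleAdj i j → Adj H (c i) (c j)
      to zero zero (inj₁ (inj₁ ()))
      to zero zero (inj₁ (inj₂ ()))
      to zero zero (inj₂ (inj₁ (() , _)))
      to zero zero (inj₂ (inj₂ (() , _)))
      to zero (suc j) (inj₁ (inj₁ eq)) =
        subst (Adj H w ∘ p) (suc-injective eq) w~p₀
      to zero (suc j) (inj₁ (inj₂ ()))
      to zero (suc j) (inj₂ (inj₁ (() , _)))
      to zero (suc j) (inj₂ (inj₂ (eq , _))) =
        subst (Adj H w ∘ p) (sym (suc-injective (suc-injective eq))) w~pₗ
      to (suc i) zero (inj₁ (inj₁ ()))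
      to (suc i) zero (inj₁ (inj₂ eq)) =
        symm H (subst (Adj H w ∘ p) (suc-injective eq) w~p₀)
      to (suc i) zero (inj₂ (inj₁ (eq , _))) =
        symm H (subst (Adj H w ∘ p) (sym (suc-injective (suc-injective eq))) w~pₗ)
      to (suc i) zero (inj₂ (inj₂ (() , _)))
      to (suc i) (suc j) (inj₁ (inj₁ eq)) = path⇒adj (≤l j) (suc-injective eq)
      to (suc i) (suc j) (inj₁ (inj₂ eq)) = symm H (path⇒adj (≤l i) (suc-injective eq))
      to (suc i) (suc j) (inj₂ (inj₁ (_ , ())))
      to (suc i) (suc j) (inj₂ (inj₂ (_ , ())))

      from : ∀ i j → Adj H (c i) (c j) → CycleAdj i j
      from zero    zero    e = contradiction refl (adj⇒≢ e)
      from zero    (suc j) e with spoke (≤l j) e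
      ... | inj₁ eq = inj₁ (inj₁ (cong suc (sym eq)))
      ... | inj₂ eq = inj₂ (inj₂ (cong 2+ eq , refl))
      from (suc i) zero    e with spoke (≤l i) (symm H e)
      ... | inj₁ eq = inj₁ (inj₂ (cong suc (sym eq)))
      ... | inj₂ eq = inj₂ (inj₁ (cong 2+ eq , refl))
      from (suc i) (suc j) e with induced (≤l i) (≤l j) e
      ... | inj₁ eq = inj₁ (inj₁ (cong suc eq))
      ... | inj₂ eq = inj₁ (inj₂ (cong suc eq))

-- Parities of tallies

parity-+ : ∀ a b c d → parity a ≡ parity b → parity c ≡ parity d →
  parity (a + c) ≡ parity (b + d)
parity-+ a b c d p q = begin
  parity (a + c)           ≡⟨ +-homo-+ a c ⟩
  parity a ℙ.+ parity c    ≡⟨ cong₂ ℙ._+_ p q ⟩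
  parity b ℙ.+ parity d    ≡⟨ +-homo-+ b d ⟨
  parity (b + d)           ∎
  where open ≡-Reasoning

parity-cancelʳ : ∀ a b c d → parity (a + c) ≡ parity (b + d) → parity c ≡ parity d →
  parity a ≡ parity b
parity-cancelʳ a b c d p q = ℙ.+-cancelʳ-≡ (parity d) (parity a) (parity b) (begin
  parity a ℙ.+ parity d    ≡⟨ cong (parity a ℙ.+_) q ⟨
  parity a ℙ.+ parity c    ≡⟨ +-homo-+ a c ⟨
  parity (a + c)           ≡⟨ p ⟩
  parity (b + d)           ≡⟨ +-homo-+ b d ⟩
  parity b ℙ.+ parity d    ∎)
  where open ≡-Reasoning

even-n+n : ∀ n → Even (n + n)
even-n+n zero    = refl
even-n+n (suc n) rewrite +-suc n n = even-n+n n

parity-+-even : ∀ a d → Even d → parity (a + d) ≡ parity a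
parity-+-even a d d-even = trans (parity-+ a a d 0 refl d-even) (cong parity (+-identityʳ a))

∑ : (ℕ → ℕ) → ℕ → ℕ
∑ f zero    = 0
∑ f (suc n) = ∑ f n + f n

∑-cong : ∀ {f g} n → (∀ {i} → i < n → f i ≡ g i) → ∑ f n ≡ ∑ g n
∑-cong zero    f≗g = refl
∑-cong (suc n) f≗g = cong₂ _+_ (∑-cong n (f≗g ∘ m<n⇒m<1+n)) (f≗g ≤-refl)

∑-zero : ∀ {f} n → (∀ {i} → i < n → f i ≡ 0) → ∑ f n ≡ 0
∑-zero zero    f≗0 = refl
∑-zero (suc n) f≗0 = cong₂ _+_ (∑-zero n (f≗0 ∘ m<n⇒m<1+n)) (f≗0 ≤-refl)

∑-+ : ∀ f g n → ∑ (λ i → f i + g i) n ≡ ∑ f n + ∑ g n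
∑-+ f g zero    = refl
∑-+ f g (suc n) rewrite ∑-+ f g n = interchange (∑ f n) (∑ g n) (f n) (g n)

indicator : ∀ {A : Set} → Dec A → ℕ
indicator A? = if does A? then 1 else 0

indicator-yes : ∀ {A : Set} (A? : Dec A) → A → indicator A? ≡ 1
indicator-yes (yes _) _ = refl
indicator-yes (no ¬a) a = contradiction a ¬a

indicator-no : ∀ {A : Set} (A? : Dec A) → ¬ A → indicator A? ≡ 0
indicator-no (yes a) ¬a = contradiction a ¬a
indicator-no (no _)  _  = refl

indicator-cong : ∀ {A B : Set} (A? : Dec A) (B? : Dec B) → (A → B) → (B → A) →
  indicator A? ≡ indicator B?
indicator-cong (yes a) B? to from = sym (indicator-yes B? (to a))
indicator-cong (no ¬a) B? to from = sym (indicator-no B? (¬a ∘ from))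

indicator-+ : ∀ {A B C : Set} (A? : Dec A) (B? : Dec B) (C? : Dec C) →
  (A → (B × ¬ C) ⊎ (¬ B × C)) → (B → A) → (C → A) →
  indicator A? ≡ indicator B? + indicator C?
indicator-+ (yes a) B? C? split _ _ with split a
... | inj₁ (b , ¬c) = sym (cong₂ _+_ (indicator-yes B? b) (indicator-no C? ¬c))
... | inj₂ (¬b , c) = sym (cong₂ _+_ (indicator-no B? ¬b) (indicator-yes C? c))
indicator-+ (no ¬a) B? C? _ b⇒a c⇒a =
  sym (cong₂ _+_ (indicator-no B? (¬a ∘ b⇒a)) (indicator-no C? (¬a ∘ c⇒a)))

tally : {E : Pred ℕ 0ℓ} → Decidable E → ℕ → ℕ
tally E? = ∑ (indicator ∘ E?)

-- Scanning from left to right, the tally has the parity of the last position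
-- at which P held.
parity-tally : {P E : Pred ℕ 0ℓ} (P? : Decidable P) (E? : Decidable E) (l : ℕ) →
  (∀ {i} → i < l → E i → P i × P (suc i)) →
  (∀ {i d} → 0 < d → i + d ≤ l → P i → P (i + d) →
    (∀ {k} → 0 < k → k < d → ¬ P (i + k)) → (d ≡ 1 × E i) ⊎ Even d) →
  P 0 → P l → parity (tally E? l) ≡ parity l
parity-tally {P} {E} P? E? l E⇒P gap P₀ Pₗ = finish (scan l ≤-refl)
  where
  Scanned : ℕ → Set
  Scanned n = ∃₂ λ b d → b + d ≡ n × P b ×
    (∀ {k} → 0 < k → k ≤ d → ¬ P (b + k)) × parity (tally E? n) ≡ parity b

  finish : Scanned l → parity (tally E? l) ≡ parity l
  finish (b , zero  , refl , _ , _  , eq) = trans eq (cong parity (sym (+-identityʳ b)))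
  finish (b , suc d , refl , _ , ¬P , _)  = contradiction Pₗ (¬P (s≤s z≤n) ≤-refl)

  step : ∀ {b d} → b + d < l → P b → (∀ {k} → 0 < k → k ≤ d → ¬ P (b + k)) →
    parity (tally E? (b + d)) ≡ parity b → Dec (P (suc (b + d))) → Scanned (suc (b + d))
  step {b} {d} n<l Pb ¬P eq (no ¬Pn) =
    b , suc d , +-suc b d , Pb , ¬P′ , trans (cong parity tally≡) eq
    where
    tally≡ : tally E? (suc (b + d)) ≡ tally E? (b + d)
    tally≡ rewrite indicator-no (E? (b + d)) (¬Pn ∘ proj₂ ∘ E⇒P n<l) = +-identityʳ _

    ¬P′ : ∀ {k} → 0 < k → k ≤ suc d → ¬ P (b + k)
    ¬P′ 0<k k≤1+d with m≤n⇒m<n∨m≡n k≤1+d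
    ... | inj₁ k<1+d = ¬P 0<k (s≤s⁻¹ k<1+d)
    ... | inj₂ refl  = ¬Pn ∘ subst P (+-suc b d)
  step {b} {d} n<l Pb ¬P eq (yes Pn) =
    suc (b + d) , 0 , +-identityʳ _ , Pn , (λ { (s≤s _) () }) ,
    jump d refl (gap (s≤s z≤n) (≤-trans (≤-reflexive (+-suc b d)) n<l) Pb
      (subst P (sym (+-suc b d)) Pn) (λ 0<k k<1+d → ¬P 0<k (s≤s⁻¹ k<1+d)))
    where
    -- A gap of one raises tally and position by one; a longer gap leaves the tally alone and moves
    -- the position by an even amount.
    jump : ∀ d′ → d ≡ d′ → (suc d ≡ 1 × E b) ⊎ Even (suc d) →
      parity (tally E? (suc (b + d))) ≡ parity (suc (b + d))
    jump zero    refl (inj₂ ())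
    jump zero    refl (inj₁ (_ , Eb))
      rewrite +-identityʳ b | indicator-yes (E? b) Eb
            | +-comm (tally E? b) 1 = parity-+ 1 1 (tally E? b) b refl eq
    jump (suc d′) refl (inj₁ (() , _))
    jump (suc d′) refl (inj₂ d-even)
      rewrite indicator-no (E? (b + d)) (¬P (s≤s z≤n) ≤-refl ∘ proj₁ ∘ E⇒P n<l)
            | +-identityʳ (tally E? (b + d)) =
      trans eq (trans (sym (parity-+-even b (2+ d′) d-even)) (cong parity (+-suc b d)))

  scan : ∀ n → n ≤ l → Scanned n
  scan zero    _   = 0 , 0 , refl , P₀ , (λ { (s≤s _) () }) , refl
  scan (suc n) n<l with scan n (<⇒≤ n<l)
  ... | b , d , refl , Pb , ¬P , eq = step n<l Pb ¬P eq (P? (suc (b + d)))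

-- Connected vertex lists

module _ {n : ℕ} (H : Graph n) where

  -- Connectedness as a building order without repetitions, which permits induction on vertices:
  -- each new vertex has a neighbour among those already listed.
  data Grown : List (Fin n) → Set where
    single : ∀ x → Grown [ x ]
    grow   : ∀ {x ys} → x ∉ ys → Any (Adj H x) ys → Grown ys → Grown (x ∷ ys)

  -- For `U` and `W` obtained from `xs` by deleting `u` and `w`, the list `Z` is what is left when
  -- both are gone: `U` adds to it at most `w`, and `W` at most `u`.
  record Core (xs : List (Fin n)) (u w : Fin n) (U W : List (Fin n)) : Set where
    field
      Z         : List (Fin n)
      Z-grown   : Grown Z
      Z-shorter : length Z < length xs
      Z⊆U       : Z ⊆ U
      Z⊆W       : Z ⊆ W
      U-split   : ∀ {z} → z ∈ U → z ≡ w ⊎ z ∈ Z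
      W-split   : ∀ {z} → z ∈ W → z ≡ u ⊎ z ∈ Z

  -- Two nonadjacent vertices R 0 and R k of xs, with the lists U and W left by
  -- deleting them one at a time, and the list left by deleting both unless k
  -- is even.
  record RemovablePair (xs : List (Fin n)) : Set where
    field
      {R}       : ℕ → Fin n
      {k}       : ℕ
      2≤k       : 2 ≤ k
      path      : Path H R k
      R∈xs      : ∀ {i} → i ≤ k → R i ∈ xs
      U W       : List (Fin n)
      U-grown   : Grown U
      W-grown   : Grown W
      U⊆xs      : U ⊆ xs
      W⊆xs      : W ⊆ xs
      U-shorter : length U < length xs
      W-shorter : length W < length xs
      U-cover   : ∀ {z} → z ∈ xs → z ≡ R 0 ⊎ z ∈ U
      W-cover   : ∀ {z} → z ∈ xs → z ≡ R k ⊎ z ∈ W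
      core      : Even k ⊎ Core xs (R 0) (R k) U W

module _ {n : ℕ} {H : Graph n} where

  cover-∷ : ∀ {x a : Fin n} {xs ys} → (∀ {z} → z ∈ xs → z ≡ a ⊎ z ∈ ys) →
    ∀ {z} → z ∈ x ∷ xs → z ≡ a ⊎ z ∈ x ∷ ys
  cover-∷ cover (here eq)  = inj₂ (here eq)
  cover-∷ cover (there z∈) = Sum.map₂ there (cover z∈)

  vertex-path : ∀ w → Path H (const w) 0
  vertex-path w = record
    { distinct = λ { (s≤s _) () } ; consecutive = λ () ; chordless = λ { (s≤s _) () } }

  two-edge-path : ∀ {u m w} → Adj H u m → Adj H m w → u ≢ w → ¬ Adj H u w →
    Path H (u ◂ m ◂ const w) 2
  two-edge-path um mw u≢w u≁w =
    cons-path
      (cons-path (vertex-path _) (const (adj⇒≢ {H = H} mw)) mw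
        (λ { (s≤s _) () }))
      (λ { {zero} _ → adj⇒≢ {H = H} um ; {suc _} _ → u≢w }) um
      (λ { {suc _} _ _ → u≁w })

  clique-grown : ∀ {x xs} → AllPairs (Adj H) (x ∷ xs) → Grown H (x ∷ xs)
  clique-grown {xs = []}     _              = single _
  clique-grown {xs = y ∷ ys} (x~ ∷ clique) =
    grow (λ x∈ → irrefl H refl (All.lookup x~ x∈)) (here (All.head x~)) (clique-grown clique)

  clique-adj : ∀ {xs u w} → AllPairs (Adj H) xs → u ∈ xs → w ∈ xs → u ≢ w → Adj H u w
  clique-adj _         (here refl) (here refl) u≢w = contradiction refl u≢w
  clique-adj (x~ ∷ _)  (here refl) (there w∈)  _   = All.lookup x~ w∈
  clique-adj (x~ ∷ _)  (there u∈)  (here refl) _   = symm H (All.lookup x~ u∈)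
  clique-adj (_ ∷ cl)  (there u∈)  (there w∈)  u≢w = clique-adj cl u∈ w∈ u≢w

  -- A sublist of a clique is a clique; `u` survives the deletion, so the result is nonempty, as
  -- `Grown` requires.
  deleted-clique-grown : ∀ {u w ys} → AllPairs (Adj H) ys → u ∈ ys → u ≢ w →
    Grown H (filter (λ z → ¬? (z ≟ᶠ w)) ys)
  deleted-clique-grown {u} {w} {ys} clique u∈ u≢w =
    go (AllPairs.filter⁺ P? clique) (∈-filter⁺ P? u∈ u≢w)
    where
    P? = λ z → ¬? (z ≟ᶠ w)
    go : ∀ {zs} → AllPairs (Adj H) zs → u ∈ zs → Grown H zs
    go {z ∷ zs} cl _ = clique-grown cl

  -- The two ends play symmetric roles, so that an argument about `U` also covers `W`.
  reverse-pair : ∀ {xs} (pair : RemovablePair H xs) → RemovablePair H xs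
  reverse-pair {xs} pair = record
    { R = reverse k R ; k = k ; 2≤k = 2≤k
    ; path = reverse-path path
    ; R∈xs = λ {i} _ → R∈xs (m∸n≤m k i)
    ; U = W ; W = U ; U-grown = W-grown ; W-grown = U-grown
    ; U⊆xs = W⊆xs ; W⊆xs = U⊆xs ; U-shorter = W-shorter ; W-shorter = U-shorter
    ; U-cover = W-cover
    ; W-cover = λ z∈ → Sum.map₁ (λ eq → trans eq R₀) (U-cover z∈)
    ; core = Sum.map₂ reverse-core core
    }
    where
    open RemovablePair pair
    R₀ : R 0 ≡ R (k ∸ k)
    R₀ = cong R (sym (n∸n≡0 k))

    reverse-core : Core H xs (R 0) (R k) U W → Core H xs (R k) (R (k ∸ k)) W U
    reverse-core c = record
      { Z = Z ; Z-grown = Z-grown ; Z-shorter = Z-shorter ; Z⊆U = Z⊆W ; Z⊆W = Z⊆U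
      ; U-split = λ z∈ → Sum.map₁ (λ eq → trans eq R₀) (W-split z∈)
      ; W-split = U-split
      }
      where open Core c

  module _ {x : Fin n} {ys : List (Fin n)} (x∉ys : x ∉ ys) (ys-grown : Grown H ys) where

    ∉⇒≢ : ∀ {y} → y ∈ ys → x ≢ y
    ∉⇒≢ y∈ys refl = x∉ys y∈ys

    -- The vertices `x`, `u`, `w` form an induced path of length 2, which is even and so settles
    -- `core`. Without `x` the clique `ys` remains; without `w`, `x` stays attached through `u`.
    clique-pair : AllPairs (Adj H) ys → ∀ {u w} → u ∈ ys → w ∈ ys →
      Adj H x u → ¬ Adj H x w → RemovablePair H (x ∷ ys)
    clique-pair clique {u} {w} u∈ w∈ x~u x≁w = record
      { R = x ◂ u ◂ const w ; k = 2 ; 2≤k = ≤-refl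
      ; path = two-edge-path x~u (clique-adj clique u∈ w∈ u≢w) (∉⇒≢ w∈) x≁w
      ; R∈xs = λ { {zero} _ → here refl ; {suc zero} _ → there u∈ ; {suc (suc _)} _ → there w∈ }
      ; U = ys ; W = x ∷ ys-w ; U-grown = ys-grown
      ; W-grown = grow (x∉ys ∘ ys-w⊆ys) (lose (∈-filter⁺ ≢w? u∈ u≢w) x~u)
                    (deleted-clique-grown clique u∈ u≢w)
      ; U⊆xs = there ; W⊆xs = ∷⁺ʳ x ys-w⊆ys
      ; U-shorter = ≤-refl
      ; W-shorter = s≤s (filter-notAll ≢w? ys (lose w∈ (_$ refl)))
      ; U-cover = λ { (here eq) → inj₁ eq ; (there z∈) → inj₂ z∈ }
      ; W-cover = cover-∷ cover
      ; core = inj₁ refl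
      }
      where
      ≢w? : ∀ z → Dec (z ≢ w)
      ≢w? z = ¬? (z ≟ᶠ w)

      ys-w = filter ≢w? ys

      ys-w⊆ys : ys-w ⊆ ys
      ys-w⊆ys = proj₁ ∘ ∈-filter⁻ ≢w?

      u≢w : u ≢ w
      u≢w refl = x≁w x~u

      cover : ∀ {z} → z ∈ ys → z ≡ w ⊎ z ∈ ys-w
      cover {z} z∈ with z ≟ᶠ w
      ... | yes eq = inj₁ eq
      ... | no z≢w = inj₂ (∈-filter⁺ ≢w? z∈ z≢w)

    module _ (pair : RemovablePair H ys) (x~ys : Any (Adj H x) ys) where
      open RemovablePair pair

      R₀≢Rₖ : R 0 ≢ R k
      R₀≢Rₖ = distinct path (≤-trans (s≤s z≤n) 2≤k) ≤-refl

      R₀≁Rₖ : ¬ Adj H (R 0) (R k)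
      R₀≁Rₖ e = <⇒≢ 2≤k (chordless path (≤-trans (s≤s z≤n) 2≤k) ≤-refl e)

      -- With no neighbour in `U`, `x` is attached to `ys` by `R 0` alone and so prolongs `R`.
      -- Deleting `x` leaves `ys`, deleting `R k` leaves `x ∷ W`, and deleting both leaves `W`.
      pendant-pair : ¬ Any (Adj H x) U → RemovablePair H (x ∷ ys)
      pendant-pair x≁U = record
        { R = x ◂ R ; k = suc k ; 2≤k = m≤n⇒m≤1+n 2≤k
        ; path = cons-path path (∉⇒≢ ∘ R∈xs) x~R₀ (λ 0<i i≤k e →
            distinct path 0<i i≤k (sym (only-neighbour (R∈xs i≤k) e)))
        ; R∈xs = λ { {zero} _ → here refl ; {suc _} (s≤s i≤k) → there (R∈xs i≤k) }
        ; U = ys ; W = x ∷ W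
        ; U-grown = ys-grown
        ; W-grown = grow (x∉ys ∘ W⊆xs) (lose R₀∈W x~R₀) W-grown
        ; U⊆xs = there ; W⊆xs = ∷⁺ʳ x W⊆xs
        ; U-shorter = ≤-refl ; W-shorter = s≤s W-shorter
        ; U-cover = λ { (here eq) → inj₁ eq ; (there z∈) → inj₂ z∈ }
        ; W-cover = cover-∷ W-cover
        ; core = inj₂ (record
            { Z = W ; Z-grown = W-grown ; Z-shorter = m<n⇒m<1+n W-shorter
            ; Z⊆U = W⊆xs ; Z⊆W = there ; U-split = W-cover
            ; W-split = λ { (here eq) → inj₁ eq ; (there z∈) → inj₂ z∈ } })
        }
        where
        only-neighbour : ∀ {z} → z ∈ ys → Adj H x z → z ≡ R 0
        only-neighbour z∈ x~z with U-cover z∈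
        ... | inj₁ eq  = eq
        ... | inj₂ z∈U = contradiction (lose z∈U x~z) x≁U

        x~R₀ : Adj H x (R 0)
        x~R₀ with z , z∈ , x~z ← find x~ys = subst (Adj H x) (only-neighbour z∈ x~z) x~z

        R₀∈W : R 0 ∈ W
        R₀∈W = [ (λ eq → contradiction eq R₀≢Rₖ) , id ]′ (W-cover (R∈xs z≤n))

      module _ (x~U : Any (Adj H x) U) (x~W : Any (Adj H x) W) where

        -- A neighbour in each of `U` and `W` lets `x` join both lists. The ends stay fixed, while
        -- the path between them may be exchanged.
        widened-pair : ∀ {R′ k′} → R′ 0 ≡ R 0 → R′ k′ ≡ R k → 2 ≤ k′ → Path H R′ k′ →
          (∀ {i} → i ≤ k′ → R′ i ∈ x ∷ ys) →
          Even k′ ⊎ Core H (x ∷ ys) (R′ 0) (R′ k′) (x ∷ U) (x ∷ W) →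
          RemovablePair H (x ∷ ys)
        widened-pair {R′} {k′} eq₀ eqₖ 2≤k′ path′ R′∈ core′ = record
          { R = R′ ; k = k′ ; 2≤k = 2≤k′ ; path = path′ ; R∈xs = R′∈
          ; U = x ∷ U ; W = x ∷ W
          ; U-grown = grow (x∉ys ∘ U⊆xs) x~U U-grown
          ; W-grown = grow (x∉ys ∘ W⊆xs) x~W W-grown
          ; U⊆xs = ∷⁺ʳ x U⊆xs ; W⊆xs = ∷⁺ʳ x W⊆xs
          ; U-shorter = s≤s U-shorter ; W-shorter = s≤s W-shorter
          ; U-cover = Sum.map₁ (λ eq → trans eq (sym eq₀)) ∘ cover-∷ U-cover
          ; W-cover = Sum.map₁ (λ eq → trans eq (sym eqₖ)) ∘ cover-∷ W-cover
          ; core = core′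
          }

        attached-pair : RemovablePair H (x ∷ ys)
        attached-pair with core
        ... | inj₁ k-even = widened-pair refl refl 2≤k path (there ∘ R∈xs) (inj₁ k-even)
        ... | inj₂ c with any? (adj? H x) (Core.Z c)
        ...   | yes x~Z = widened-pair refl refl 2≤k path (there ∘ R∈xs) (inj₂ (record
                  { Z = x ∷ Z ; Z-grown = grow (x∉ys ∘ U⊆xs ∘ Z⊆U) x~Z Z-grown
                  ; Z-shorter = s≤s Z-shorter ; Z⊆U = ∷⁺ʳ x Z⊆U ; Z⊆W = ∷⁺ʳ x Z⊆W
                  ; U-split = cover-∷ U-split ; W-split = cover-∷ W-split }))
                where open Core c
        -- Missing `Z`, `x` can meet `U` only in `R k` and `W` only in `R 0`. The new path `R 0`,
        -- `x`, `R k` has even length, the first alternative of `core`.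
        ...   | no x≁Z = widened-pair {R 0 ◂ x ◂ const (R k)} {2} refl refl ≤-refl
                  (two-edge-path (symm H (beyond-Z x~W W-split)) (beyond-Z x~U U-split) R₀≢Rₖ R₀≁Rₖ)
                  (λ { {zero} _ → there (R∈xs z≤n) ; {suc zero} _ → here refl
                     ; {suc (suc _)} _ → there (R∈xs ≤-refl) })
                  (inj₁ refl)
                where
                open Core c
                beyond-Z : ∀ {a V} → Any (Adj H x) V → (∀ {z} → z ∈ V → z ≡ a ⊎ z ∈ Z) → Adj H x a
                beyond-Z x~V split with find x~V
                ... | z , z∈ , x~z with split z∈
                ...   | inj₁ refl = x~z
                ...   | inj₂ z∈Z  = contradiction (lose z∈Z x~z) x≁Z

  -- Vertices are added in the order of growth: a clique stays one or yields a pair, and a pair is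
  -- prolonged if the new vertex misses `U` or `W`, and widened otherwise.
  clique-or-pair : ∀ {xs} → Grown H xs → AllPairs (Adj H) xs ⊎ RemovablePair H xs
  clique-or-pair (single x) = inj₁ ([] ∷ [])
  clique-or-pair (grow {x} {ys} x∉ys x~ys ys-grown) with clique-or-pair ys-grown
  ... | inj₁ clique with all? (adj? H x) ys
  ...   | yes x~all = inj₁ (x~all ∷ clique)
  ...   | no x≁some
          with u , u∈ , x~u ← find x~ys
             | w , w∈ , x≁w ← find (¬All⇒Any¬ (adj? H x) ys x≁some) =
          inj₂ (clique-pair x∉ys ys-grown clique u∈ w∈ x~u x≁w)
  clique-or-pair (grow {x} {ys} x∉ys x~ys ys-grown) | inj₂ pair
    with any? (adj? H x) (RemovablePair.U pair) | any? (adj? H x) (RemovablePair.W pair)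
  ... | no x≁U  | _       = inj₂ (pendant-pair x∉ys ys-grown pair x~ys x≁U)
  ... | yes _   | no x≁W  = inj₂ (pendant-pair x∉ys ys-grown (reverse-pair pair) x~ys x≁W)
  ... | yes x~U | yes x~W = inj₂ (attached-pair x∉ys ys-grown pair x~ys x~U x~W)

-- Gaps between complete vertices

even? : ∀ k → Dec (Even k)
even? k = parity k ≟ᵖ 0ℙ

consecutive-parity : ∀ k → Even k → ¬ Even (suc k)
consecutive-parity (suc (suc k)) = consecutive-parity k

odd⇒even-suc : ∀ k → ¬ Even k → Even (suc k)
odd⇒even-suc zero          ¬even = contradiction refl ¬even
odd⇒even-suc (suc zero)    _     = refl
odd⇒even-suc (suc (suc k)) ¬even = odd⇒even-suc k ¬even

module _ {n : ℕ} (G : Graph n) where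

  CompleteTo : List (Fin n) → Pred (Fin n) 0ℓ
  CompleteTo xs u = All (Adj G u) xs

  restrict : ∀ {xs ys u} → ys ⊆ xs → CompleteTo xs u → CompleteTo ys u
  restrict ys⊆xs c = All.tabulate (All.lookup c ∘ ys⊆xs)

  complete-cover : ∀ {xs ys x u} → (∀ {z} → z ∈ xs → z ≡ x ⊎ z ∈ ys) →
    Adj G u x → CompleteTo ys u → CompleteTo xs u
  complete-cover {u = u} cover u~x u~ys = All.tabulate λ z∈ →
    [ (λ eq → subst (Adj G u) (sym eq) u~x) , All.lookup u~ys ]′ (cover z∈)

  completeTo? : ∀ xs → Decidable (CompleteTo xs)
  completeTo? xs u = all? (adj? G u) xs

  CompleteStep : List (Fin n) → (ℕ → Fin n) → Pred ℕ 0ℓ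
  CompleteStep xs p i = CompleteTo xs (p i) × CompleteTo xs (p (suc i))

  completeStep? : ∀ xs p → Decidable (CompleteStep xs p)
  completeStep? xs p i = completeTo? xs (p i) ×-dec completeTo? xs (p (suc i))

  -- The situation of the key claim, with `v` as the further complete vertex; `v` may be adjacent to
  -- the ends of the path.
  record Probe (xs : List (Fin n)) (p : ℕ → Fin n) (l : ℕ) (v : Fin n) : Set where
    field
      path           : Path G p l
      avoids         : ∀ {i} → i ≤ l → p i ∉ xs
      fresh          : ∀ {i} → i ≤ l → v ≢ p i
      isolated       : ∀ {i} → 0 < i → i < l → ¬ Adj G v (p i)
      apex-complete  : CompleteTo xs v
      first-complete : CompleteTo xs (p 0)
      last-complete  : CompleteTo xs (p l)

  GapParity : List (Fin n) → Set
  GapParity xs = ∀ {p l v} → Probe xs p l v →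
    (∀ {i} → 0 < i → i < l → ¬ CompleteTo xs (p i)) → l ≡ 1 ⊎ Even l

  -- The form in which the induction hypothesis is used: inner vertices may now be complete as well.
  EdgeParity : List (Fin n) → Set
  EdgeParity xs = ∀ {p l v} → Probe xs p l v →
    parity (tally (completeStep? xs p) l) ≡ parity l

module _ {n : ℕ} {G : Graph n} where

  restrict-probe : ∀ {xs ys p l v} → ys ⊆ xs → Probe G xs p l v → Probe G ys p l v
  restrict-probe ys⊆xs pr = record
    { path = path ; avoids = λ i≤l → avoids i≤l ∘ ys⊆xs ; fresh = fresh ; isolated = isolated
    ; apex-complete = restrict G ys⊆xs apex-complete
    ; first-complete = restrict G ys⊆xs first-complete
    ; last-complete = restrict G ys⊆xs last-complete
    }
    where open Probe pr

  segment-probe : ∀ {xs p l v a d} → Probe G xs p l v → a + d ≤ l →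
    CompleteTo G xs (p a) → CompleteTo G xs (p (a + d)) → Probe G xs (segment a p) d v
  segment-probe {xs} {p} {l} {v} {a} {d} pr a+d≤l c₀ c = record
    { path = segment-path path a+d≤l
    ; avoids = avoids ∘ bound ; fresh = fresh ∘ bound
    ; isolated = λ {i} 0<i i<d → isolated (≤-trans 0<i (m≤n+m i a))
        (<-≤-trans (+-monoʳ-< a i<d) a+d≤l)
    ; apex-complete = apex-complete
    ; first-complete = subst (CompleteTo G xs ∘ p) (sym (+-identityʳ a)) c₀
    ; last-complete = c
    }
    where
    open Probe pr
    bound : ∀ {i} → i ≤ d → a + i ≤ l
    bound i≤d = ≤-trans (+-monoʳ-≤ a i≤d) a+d≤l

  -- The stretch between two successive complete vertices is again a probe with the same apex, so
  -- each gap is a single edge or even, and the gaps add up.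
  gap⇒edge : ∀ {xs} → GapParity G xs → EdgeParity G xs
  gap⇒edge {xs} gap {p} {l} pr =
    parity-tally (completeTo? G xs ∘ p) (completeStep? G xs p) l (const id) gaps
      first-complete last-complete
    where
    open Probe pr
    gaps : ∀ {i d} → 0 < d → i + d ≤ l → CompleteTo G xs (p i) → CompleteTo G xs (p (i + d)) →
      (∀ {k} → 0 < k → k < d → ¬ CompleteTo G xs (p (i + k))) →
      (d ≡ 1 × CompleteStep G xs p i) ⊎ Even d
    gaps {i} _ i+d≤l cᵢ c inner with gap (segment-probe pr i+d≤l cᵢ c) inner
    ... | inj₁ refl = inj₁ (refl , cᵢ , subst (CompleteTo G xs ∘ p) (+-comm i 1) c)
    ... | inj₂ even = inj₂ even

  odd⇒complete-step : ∀ {xs p l v} → EdgeParity G xs → Probe G xs p l v → ¬ Even l →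
    ∃ λ i → i < l × CompleteStep G xs p i
  odd⇒complete-step {xs} {p} {l} edge pr odd with anyUpTo? (completeStep? G xs p) l
  ... | yes found = found
  ... | no ¬found = contradiction
          (trans (sym (edge pr)) (cong parity (∑-zero l λ {i} i<l →
            indicator-no (completeStep? G xs p i) (λ c → ¬found (i , i<l , c)))))
          odd

  -- Inclusion–exclusion on a ∧ o and a ∨ o, relative to s.
  inclusion-exclusion : ∀ a s o →
    (if (a ∧ s) ∧ o then 1 else 0) + (if s ∧ (a ∨ o) then 1 else 0) ≡
    (if s ∧ (a ∨ false) then 1 else 0) + (if s ∧ o then 1 else 0)
  inclusion-exclusion true  true  true  = refl
  inclusion-exclusion true  true  false = refl
  inclusion-exclusion true  false true  = refl
  inclusion-exclusion true  false false = refl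
  inclusion-exclusion false true  true  = refl
  inclusion-exclusion false true  false = refl
  inclusion-exclusion false false true  = refl
  inclusion-exclusion false false false = refl

  -- Stable sets: holes and inclusion-exclusion

  module _ (even-holes : EvenHoles G) {xs : List (Fin n)}
           (stable : AllPairs (Adj (complement G)) xs)
           {p : ℕ → Fin n} {l : ℕ} {v : Fin n} (pr : Probe G xs p l v) where
    open Probe pr

    Both : ℕ → Pred (Fin n) 0ℓ
    Both i y = Adj G (p i) y × Adj G (p (suc i)) y

    both? : ∀ i → Decidable (Both i)
    both? i y = adj? G (p i) y ×-dec adj? G (p (suc i)) y

    common? : ∀ ys i → Dec (Any (Both i) ys)
    common? ys i = any? (both? i) ys

    -- Interpolates between the edges with a common neighbour in `ys`, for `ss` empty, and, for `ys`
    -- a singleton, the edges with both ends complete to `ss` and to that one vertex.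
    mixed? : ∀ ss ys i → Dec (All (Both i) ss × Any (Both i) ys)
    mixed? ss ys i = all? (both? i) ss ×-dec any? (both? i) ys

    module _ {ys : List (Fin n)} (ys⊆xs : ys ⊆ xs) where

      gap-with-common-neighbour : ∀ {i d y} → 0 < d → i + d ≤ l → y ∈ ys →
        Adj G (p i) y → Adj G (p (i + d)) y →
        (∀ {k} → 0 < k → k < d → ¬ Any (Adj G (p (i + k))) ys) → d ≡ 1 ⊎ Even d
      gap-with-common-neighbour {i} {suc zero} _ _ _ _ _ _ = inj₁ refl
      gap-with-common-neighbour {i} {suc (suc d)} {y} _ i+d≤l y∈ e₀ e inner = inj₂
        (path-closed-by-vertex (segment-path path i+d≤l) even-holes (s≤s (s≤s z≤n))
          (λ {k} k≤d eq → avoids (≤-trans (+-monoʳ-≤ i k≤d) i+d≤l) (subst (_∈ xs) eq (ys⊆xs y∈)))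
          (subst (Adj G y ∘ p) (sym (+-identityʳ i)) (symm G e₀)) (symm G e)
          (λ 0<k k<d e → inner 0<k k<d (lose y∈ (symm G e))))

      -- The cycle `v`, `y`, `p i`, ..., `p (i + d)`, `y′` is a hole of length `4 + d`; `y` and `y′`
      -- are nonadjacent because `xs` is stable.
      gap-without-common-neighbour : ∀ {i d y y′} → 0 < d → i + d ≤ l → y ∈ ys → y′ ∈ ys →
        Adj G (p i) y → Adj G (p (i + d)) y′ → ¬ Adj G (p (i + d)) y → ¬ Adj G (p i) y′ →
        (∀ {k} → 0 < k → k < d → ¬ Any (Adj G (p (i + k))) ys) → Even d
      gap-without-common-neighbour {i} {d} {y} {y′} 0<d i+d≤l y∈ y′∈ e e′ ¬e ¬e′ inner =
        path-closed-by-vertex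
          (cons-path
            (cons-path (segment-path path i+d≤l) (∉p y∈)
              (subst (Adj G y ∘ p) (sym (+-identityʳ i)) (symm G e))
              (λ 0<k k≤d yk → y≁ 0<k k≤d (symm G yk)))
            (λ { {zero} _ → adj⇒≢ {H = G} v~y ; {suc k} (s≤s k≤d) → fresh (bound k≤d) })
            v~y
            (λ { {suc k} _ (s≤s k≤d) → isolated (≤-trans 0<i (m≤m+n i k)) (<-≤-trans′ k≤d) }))
          even-holes (s≤s (s≤s z≤n))
          (λ { {zero} _ → adj⇒≢ {H = G} (symm G v~y′)
             ; {suc zero} _ eq → y≢y′ (sym eq)
             ; {suc (suc k)} (s≤s (s≤s k≤d)) → ∉p y′∈ k≤d })
          (symm G v~y′) (symm G e′)
          (λ { {suc zero} _ _ e → proj₂ y≁y′ (symm G e)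
             ; {suc (suc k)} _ (s≤s (s≤s k<d)) e → y′≁ k<d (symm G e) })
        where
        bound : ∀ {k} → k ≤ d → i + k ≤ l
        bound k≤d = ≤-trans (+-monoʳ-≤ i k≤d) i+d≤l

        ∉p : ∀ {z k} → z ∈ ys → k ≤ d → z ≢ p (i + k)
        ∉p z∈ k≤d eq = avoids (bound k≤d) (subst (_∈ xs) eq (ys⊆xs z∈))

        y≢y′ : y ≢ y′
        y≢y′ refl = ¬e e′

        y≁y′ : Adj (complement G) y y′
        y≁y′ = clique-adj {H = complement G} stable (ys⊆xs y∈) (ys⊆xs y′∈) y≢y′

        v~y : Adj G v y
        v~y = All.lookup apex-complete (ys⊆xs y∈)

        v~y′ : Adj G v y′
        v~y′ = All.lookup apex-complete (ys⊆xs y′∈)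

        -- The ends of `p` are adjacent to both `y` and `y′`, so the segment lies in the interior of
        -- `p`, where `v` has no neighbour.
        0<i : 0 < i
        0<i = n≢0⇒n>0 λ { refl → ¬e′ (All.lookup first-complete (ys⊆xs y′∈)) }

        i+d<l : i + d < l
        i+d<l = ≤∧≢⇒< i+d≤l λ eq →
          ¬e (All.lookup (subst (CompleteTo G xs ∘ p) (sym eq) last-complete) (ys⊆xs y∈))

        <-≤-trans′ : ∀ {k} → k ≤ d → i + k < l
        <-≤-trans′ k≤d = ≤-<-trans (+-monoʳ-≤ i k≤d) i+d<l

        y≁ : ∀ {k} → 0 < k → k ≤ d → ¬ Adj G (p (i + k)) y
        y≁ 0<k k≤d ky with m≤n⇒m<n∨m≡n k≤d
        ... | inj₁ k<d  = inner 0<k k<d (lose y∈ ky)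
        ... | inj₂ refl = ¬e ky

        y′≁ : ∀ {k} → k < d → ¬ Adj G (p (i + k)) y′
        y′≁ {zero}  _   e = ¬e′ (subst (λ j → Adj G (p j) y′) (+-identityʳ i) e)
        y′≁ {suc k} k<d e = inner (s≤s z≤n) k<d (lose y′∈ e)

    -- The vertices with some neighbour in the list are scanned. Whether the two ends of a gap share
    -- such a neighbour decides which hole to use.
    parity-common : ∀ {y ys} → y ∷ ys ⊆ xs → parity (tally (common? (y ∷ ys)) l) ≡ parity l
    parity-common {y} {ys} ⊆xs =
      parity-tally (λ i → any? (adj? G (p i)) (y ∷ ys)) (common? (y ∷ ys)) l
        (λ _ c → Any.map proj₁ c , Any.map proj₂ c) gaps
        (here (All.lookup first-complete (⊆xs (here refl))))
        (here (All.lookup last-complete (⊆xs (here refl))))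
      where
      gaps : ∀ {i d} → 0 < d → i + d ≤ l →
        Any (Adj G (p i)) (y ∷ ys) → Any (Adj G (p (i + d))) (y ∷ ys) →
        (∀ {k} → 0 < k → k < d → ¬ Any (Adj G (p (i + k))) (y ∷ ys)) →
        (d ≡ 1 × Any (Both i) (y ∷ ys)) ⊎ Even d
      gaps {i} {d} 0<d i+d≤l t t′ inner
        with any? (λ z → adj? G (p i) z ×-dec adj? G (p (i + d)) z) (y ∷ ys)
      ... | yes c with z , z∈ , e , e′ ← find c
                  with gap-with-common-neighbour ⊆xs 0<d i+d≤l z∈ e e′ inner
      ...   | inj₂ even = inj₂ even
      ...   | inj₁ refl = inj₁ (refl , lose z∈ (e , subst (λ j → Adj G (p j) z) (+-comm i 1) e′))
      gaps {i} {d} 0<d i+d≤l t t′ inner | no ¬c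
        with z , z∈ , e ← find t | z′ , z′∈ , e′ ← find t′ =
        inj₂ (gap-without-common-neighbour ⊆xs 0<d i+d≤l z∈ z′∈ e e′
          (λ e″ → ¬c (lose z∈ (e , e″))) (λ e″ → ¬c (lose z′∈ (e″ , e′))) inner)

    -- Induction on `ss`: moving `s` between the two lists relates four tallies. Three of them have
    -- the parity of `l` by induction, hence so has the fourth.
    parity-mixed : ∀ ss {y ys} → ss ⊆ xs → y ∷ ys ⊆ xs →
      parity (tally (mixed? ss (y ∷ ys)) l) ≡ parity l
    parity-mixed [] {y} {ys} ss⊆ ys⊆ = trans
      (cong parity (∑-cong l λ {i} _ → indicator-cong (mixed? [] (y ∷ ys) i) (common? (y ∷ ys) i) proj₂ ([] ,_)))
      (parity-common ys⊆)
    parity-mixed (s ∷ ss) {y} {ys} ss⊆ ys⊆ =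
      parity-cancelʳ (tally (mixed? (s ∷ ss) (y ∷ ys)) l) l
                     (tally (mixed? ss (s ∷ y ∷ ys)) l) l
        (trans (cong parity exchange)
          (parity-+ (tally (mixed? ss [ s ]) l) l (tally (mixed? ss (y ∷ ys)) l) l
            (parity-mixed ss (ss⊆ ∘ there) [s]⊆)
            (parity-mixed ss (ss⊆ ∘ there) ys⊆)))
        (parity-mixed ss (ss⊆ ∘ there) s∷⊆)
      where
      [s]⊆ : [ s ] ⊆ xs
      [s]⊆ (here eq) = ss⊆ (here eq)

      s∷⊆ : s ∷ y ∷ ys ⊆ xs
      s∷⊆ (here eq)  = ss⊆ (here eq)
      s∷⊆ (there z∈) = ys⊆ z∈

      exchange : tally (mixed? (s ∷ ss) (y ∷ ys)) l + tally (mixed? ss (s ∷ y ∷ ys)) l ≡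
                 tally (mixed? ss [ s ]) l + tally (mixed? ss (y ∷ ys)) l
      -- The truth values of `all?` and `any?` on a cons unfold to a conjunction and a disjunction,
      -- so the identity applies position by position.
      exchange = trans (sym (∑-+ _ _ l)) (trans
        (∑-cong l λ {i} _ → inclusion-exclusion (does (both? i s))
          (does (all? (both? i) ss)) (does (any? (both? i) (y ∷ ys))))
        (∑-+ _ _ l))

  -- With `ss = xs` and the single vertex `x` as second list, the mixed edges are exactly the
  -- complete ones.
  stable-edge-parity : EvenHoles G → ∀ {x xs} → AllPairs (Adj (complement G)) (x ∷ xs) →
    EdgeParity G (x ∷ xs)
  stable-edge-parity even-holes {x} {xs} stable {p} {l} pr = trans
    (cong parity (∑-cong l λ {i} _ → indicator-cong
      (completeStep? G (x ∷ xs) p i) (mixed? even-holes stable pr xs [ x ] i)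
      (λ { (c ∷ cs , c′ ∷ cs′) → All.zip (cs , cs′) , here (c , c′) })
      (λ { (cs , here (c , c′)) → c ∷ All.map proj₁ cs , c′ ∷ All.map proj₂ cs })))
    (parity-mixed even-holes stable pr xs there [x]⊆)
    where
    [x]⊆ : [ x ] ⊆ x ∷ xs
    [x]⊆ (here eq) = here eq

-- Antiholes through an antipath

module _ {n : ℕ} {G : Graph n} where

  adj⇒¬coadj : ∀ {u w} → Adj G u w → ¬ Adj (complement G) u w
  adj⇒¬coadj uw (_ , u≁w) = u≁w uw

  module _ (even-antiholes : EvenHoles (complement G)) {R : ℕ → Fin n} {k : ℕ}
           (path : Path (complement G) R k) (2≤k : 2 ≤ k) where

    -- In the complement, `R 0` is the one neighbour of `a` on the antipath. Inner vertices of `p`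
    -- complete to `U` are of this type, those complete to `W` of the mirror type.
    record MissesFirst (a : Fin n) : Set where
      field
        off   : ∀ {i} → i ≤ k → a ≢ R i
        miss  : ¬ Adj G a (R 0)
        joins : ∀ {i} → 0 < i → i ≤ k → Adj G a (R i)

    record MissesLast (b : Fin n) : Set where
      field
        off   : ∀ {i} → i ≤ k → b ≢ R i
        miss  : ¬ Adj G b (R k)
        joins : ∀ {i} → i < k → Adj G b (R i)

    JoinsAll : Fin n → Set
    JoinsAll v = ∀ {i} → i ≤ k → Adj G v (R i)

    joins⇒off : ∀ {v} → JoinsAll v → ∀ {i} → i ≤ k → v ≢ R i
    joins⇒off v~R i≤k = adj⇒≢ {H = G} (v~R i≤k)

    private
      H = complement G

      0<k : 0 < k
      0<k = ≤-trans (s≤s z≤n) 2≤k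

    module _ {a : Fin n} (ma : MissesFirst a) where
      private module A = MissesFirst ma

      a◂path : Path H (a ◂ R) (suc k)
      a◂path = cons-path path A.off (A.off z≤n , A.miss) (λ 0<i i≤k → adj⇒¬coadj (A.joins 0<i i≤k))

      module _ {b : Fin n} (mb : MissesLast b) where
        private module B = MissesLast mb

        first≢last : a ≢ b
        first≢last refl = A.miss (B.joins 0<k)

        b~Rₖ : Adj H b (R k)
        b~Rₖ = B.off ≤-refl , B.miss

        -- In the complement, `a`, `R 0`, ..., `R k`, `b` is a cycle without chords, of length
        -- `3 + k`.
        antihole-two : ¬ Adj G a b → Even (suc k)
        antihole-two a≁b = path-closed-by-vertex a◂path even-antiholes (m≤n⇒m≤1+n 2≤k)
          (λ { {zero} _ → first≢last ∘ sym ; {suc i} (s≤s i≤k) → B.off i≤k })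
          (first≢last ∘ sym , a≁b ∘ symm G) b~Rₖ
          (λ { {suc i} _ (s≤s i<k) → adj⇒¬coadj (B.joins i<k) })

        -- When `a` and `b` are adjacent in `G`, the vertex `v` links them in the complement, which
        -- gives an antihole of length `4 + k`.
        antihole-three : ∀ {v} → JoinsAll v → v ≢ a → v ≢ b → ¬ Adj G v a → ¬ Adj G v b →
          Adj G a b → Even (2+ k)
        antihole-three v~R v≢a v≢b v≁a v≁b a~b = path-closed-by-vertex
          (cons-path a◂path (λ { {zero} _ → v≢a ; {suc i} (s≤s i≤k) → joins⇒off v~R i≤k })
            (v≢a , v≁a) (λ { {suc i} _ (s≤s i≤k) → adj⇒¬coadj (v~R i≤k) }))
          even-antiholes (m≤n⇒m≤1+n (m≤n⇒m≤1+n 2≤k))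
          (λ { {zero} _ → v≢b ∘ sym ; {suc zero} _ → first≢last ∘ sym
             ; {suc (suc i)} (s≤s (s≤s i≤k)) → B.off i≤k })
          (v≢b ∘ sym , v≁b ∘ symm G) b~Rₖ
          (λ { {suc zero} _ _ → adj⇒¬coadj (symm G a~b)
             ; {suc (suc i)} _ (s≤s (s≤s i<k)) → adj⇒¬coadj (B.joins i<k) })

        -- Complementing the path s, a, b, t of length 3 gives b, s, t, a.
        antihole-four : ∀ {s t} → JoinsAll s → JoinsAll t → Adj G s a → Adj G a b → Adj G b t →
          s ≢ t → ¬ Adj G s t → s ≢ b → ¬ Adj G s b → t ≢ a → ¬ Adj G t a → Even (3 + k)
        antihole-four s~R t~R s~a a~b b~t s≢t s≁t s≢b s≁b t≢a t≁a = path-closed-by-vertex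
          (cons-path
            (cons-path a◂path
              (λ { {zero} _ → t≢a ; {suc i} (s≤s i≤k) → joins⇒off t~R i≤k })
              (t≢a , t≁a) (λ { {suc i} _ (s≤s i≤k) → adj⇒¬coadj (t~R i≤k) }))
            (λ { {zero} _ → s≢t ; {suc zero} _ → adj⇒≢ {H = G} s~a
               ; {suc (suc i)} (s≤s (s≤s i≤k)) → joins⇒off s~R i≤k })
            (s≢t , s≁t)
            (λ { {suc zero} _ _ → adj⇒¬coadj s~a ; {suc (suc i)} _ (s≤s (s≤s i≤k)) → adj⇒¬coadj (s~R i≤k) }))
          even-antiholes (s≤s (s≤s z≤n))
          (λ { {zero} _ → s≢b ∘ sym ; {suc zero} _ → adj⇒≢ {H = G} b~t
             ; {suc (suc zero)} _ → first≢last ∘ sym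
             ; {suc (suc (suc i))} (s≤s (s≤s (s≤s i≤k))) → B.off i≤k })
          (s≢b ∘ sym , s≁b ∘ symm G) b~Rₖ
          (λ { {suc zero} _ _ → adj⇒¬coadj b~t ; {suc (suc zero)} _ _ → adj⇒¬coadj (symm G a~b)
             ; {suc (suc (suc i))} _ (s≤s (s≤s (s≤s i<k))) → adj⇒¬coadj (B.joins i<k) })

  -- Contradiction from a removable pair

  module _ (even-antiholes : EvenHoles (complement G)) {xs : List (Fin n)}
           (pair : RemovablePair (complement G) xs)
           (edge : ∀ {ys} → Grown (complement G) ys → length ys < length xs → EdgeParity G ys)
           {p : ℕ → Fin n} {l : ℕ} {v : Fin n} (pr : Probe G xs p l v)
           (incomplete : ∀ {i} → 0 < i → i < l → ¬ CompleteTo G xs (p i))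
           (l≢1 : l ≢ 1) (l-odd : ¬ Even l) where

    open RemovablePair pair renaming (path to antipath)
    open Probe pr

    2≤l : 2 ≤ l
    2≤l = go l l≢1 l-odd
      where
      go : ∀ m → m ≢ 1 → ¬ Even m → 2 ≤ m
      go zero          _   odd = contradiction refl odd
      go (suc zero)    m≢1 _   = contradiction refl m≢1
      go (suc (suc m)) _   _   = s≤s (s≤s z≤n)

    Inner : ℕ → Set
    Inner i = 0 < i × i < l

    off-antipath : ∀ {i} → i ≤ l → ∀ {j} → j ≤ k → p i ≢ R j
    off-antipath i≤l j≤k eq = avoids i≤l (subst (_∈ xs) (sym eq) (R∈xs j≤k))

    complete⇒joins-all : ∀ {u} → CompleteTo G xs u → ∀ {j} → j ≤ k → Adj G u (R j)
    complete⇒joins-all c j≤k = All.lookup c (R∈xs j≤k)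

    joins-U : ∀ {u} → CompleteTo G U u → ∀ {j} → 0 < j → j ≤ k → Adj G u (R j)
    joins-U c 0<j j≤k = All.lookup c
      ([ (λ eq → contradiction (sym eq) (distinct antipath 0<j j≤k)) , id ]′ (U-cover (R∈xs j≤k)))

    joins-W : ∀ {u} → CompleteTo G W u → ∀ {j} → j < k → Adj G u (R j)
    joins-W c j<k = All.lookup c
      ([ (λ eq → contradiction eq (distinct antipath j<k ≤-refl)) , id ]′ (W-cover (R∈xs (<⇒≤ j<k))))

    -- Adjacency to `R 0` as well would make the vertex complete to `xs`.
    U-misses-first : ∀ {i} → Inner i → CompleteTo G U (p i) →
      MissesFirst even-antiholes antipath 2≤k (p i)
    U-misses-first (0<i , i<l) c = record
      { off = off-antipath (<⇒≤ i<l)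
      ; miss = λ e → incomplete 0<i i<l (complete-cover G U-cover e c)
      ; joins = joins-U c }

    W-misses-last : ∀ {i} → Inner i → CompleteTo G W (p i) →
      MissesLast even-antiholes antipath 2≤k (p i)
    W-misses-last (0<i , i<l) c = record
      { off = off-antipath (<⇒≤ i<l)
      ; miss = λ e → incomplete 0<i i<l (complete-cover G W-cover e c)
      ; joins = joins-W c }

    -- Completeness to `W` includes adjacency to `R 0`, the only vertex of `xs` that `U` may lack.
    not-both : ∀ {i} → Inner i → CompleteTo G U (p i) → ¬ CompleteTo G W (p i)
    not-both (0<i , i<l) cU cW = incomplete 0<i i<l
      (complete-cover G U-cover (joins-W cW (≤-trans (s≤s z≤n) 2≤k)) cU)

    odd⇒U-step : ∃ λ i → i < l × CompleteStep G U p i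
    odd⇒U-step = odd⇒complete-step (edge U-grown U-shorter) (restrict-probe U⊆xs pr) l-odd

    odd⇒W-step : ∃ λ i → i < l × CompleteStep G W p i
    odd⇒W-step = odd⇒complete-step (edge W-grown W-shorter) (restrict-probe W⊆xs pr) l-odd

    -- As `2 ≤ l`, the right end of the first step and the left end of every other step are inner.
    step-end : ∀ {ys i} → i < l → CompleteStep G ys p i →
      ∃ λ j → Inner j × CompleteTo G ys (p j)
    step-end {i = zero}  _   (_ , c) = 1 , (s≤s z≤n , 2≤l) , c
    step-end {i = suc i} i<l (c , _) = suc i , (s≤s z≤n , i<l) , c

    module EvenAntipath (k-even : Even k) where

      -- Otherwise there is an antihole of odd length `3 + k`.
      adjacent : ∀ {i j} → Inner i → Inner j → CompleteTo G U (p i) → CompleteTo G W (p j) →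
        Adj G (p i) (p j)
      adjacent {i} {j} inᵢ inⱼ cU cW with adj? G (p i) (p j)
      ... | yes e = e
      ... | no ¬e = contradiction
        (antihole-two even-antiholes antipath 2≤k (U-misses-first inᵢ cU) (W-misses-last inⱼ cW) ¬e)
        (consecutive-parity k k-even)

      neighbours : ∀ {i j} → Inner i → Inner j → Adj G (p i) (p j) → suc i ≡ j ⊎ suc j ≡ i
      neighbours (_ , i<l) (_ , j<l) = induced path (<⇒≤ i<l) (<⇒≤ j<l)

      -- A step with both ends inner would form a triangle with p m.
      outer-step : ∀ {ys i} → i < l → CompleteStep G ys p i → ∀ {m} → Inner m →
        (∀ {j} → Inner j → CompleteTo G ys (p j) → Adj G (p j) (p m)) →
        CompleteTo G ys (p 1) ⊎ (∃ λ j → suc j ≡ l × Inner j × CompleteTo G ys (p j))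
      outer-step {i = zero}  _ (_ , c) _ _ = inj₁ c
      outer-step {i = suc i} i<l (c , c′) {m} inₘ ~m with m≤n⇒m<n∨m≡n i<l
      ... | inj₂ eq = inj₂ (suc i , eq , (s≤s z≤n , i<l) , c)
      ... | inj₁ 2+i<l
        with neighbours (s≤s z≤n , i<l) inₘ (~m (s≤s z≤n , i<l) c)
           | neighbours (s≤s z≤n , 2+i<l) inₘ (~m (s≤s z≤n , 2+i<l) c′)
      ...   | inj₁ refl | inj₁ eq = contradiction (sym eq) m≢1+m
        where
        m≢1+m : ∀ {m} → m ≢ suc m
        m≢1+m ()
      ...   | inj₁ refl | inj₂ ()
      ...   | inj₂ refl | inj₁ ()
      ...   | inj₂ refl | inj₂ ()

      -- Position `j` is the last inner one; adjacency to `p 1` puts it at 2, whence `l` is 3.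
      length-three : ∀ {j} → suc j ≡ l → Inner j → Adj G (p 1) (p j) → j ≡ 2
      length-three eq inⱼ e with neighbours (s≤s z≤n , 2≤l) inⱼ e
      ... | inj₁ 2≡j = sym 2≡j
      ... | inj₂ refl = contradiction (proj₁ inⱼ) λ ()

      module _ (l≡3 : 3 ≡ l) where

        P₃ : Path G p 3
        P₃ = subst (Path G p) (sym l≡3) path

        c₀ : ∀ {j} → j ≤ k → Adj G (p 0) (R j)
        c₀ = complete⇒joins-all first-complete

        c₃ : ∀ {j} → j ≤ k → Adj G (p 3) (R j)
        c₃ = complete⇒joins-all (subst (CompleteTo G xs ∘ p) (sym l≡3) last-complete)

        in₁ : Inner 1
        in₁ = s≤s z≤n , subst (1 <_) l≡3 (s≤s (s≤s z≤n))

        in₂ : Inner 2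
        in₂ = s≤s z≤n , subst (2 <_) l≡3 ≤-refl

        far : ∀ {i j} → suc i < j → j ≤ 3 → p i ≢ p j × ¬ Adj G (p i) (p j)
        far i+1<j j≤3 = distinct P₃ (<-trans (n<1+n _) i+1<j) j≤3 ,
          λ e → <⇒≢ i+1<j (chordless P₃ (<-trans (n<1+n _) i+1<j) j≤3 e)

        far-sym : ∀ {i j} → p i ≢ p j × ¬ Adj G (p i) (p j) → p j ≢ p i × ¬ Adj G (p j) (p i)
        far-sym (ne , na) = ne ∘ sym , na ∘ symm G

        p₀₁ = consecutive P₃ {0} (s≤s z≤n)
        p₁₂ = consecutive P₃ {1} (s≤s (s≤s z≤n))
        p₂₃ = consecutive P₃ {2} (s≤s (s≤s (s≤s z≤n)))
        p₀₂ = far {0} {2} ≤-refl (s≤s (s≤s z≤n))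
        p₁₃ = far {1} {3} ≤-refl ≤-refl
        p₀₃ = far {0} {3} (s≤s (s≤s z≤n)) ≤-refl

        UW : CompleteTo G U (p 1) → CompleteTo G W (p 2) → Even (3 + k)
        UW cU cW = antihole-four even-antiholes antipath 2≤k
          (U-misses-first in₁ cU) (W-misses-last in₂ cW) c₀ c₃ p₀₁ p₁₂ p₂₃
          (proj₁ p₀₃) (proj₂ p₀₃) (proj₁ p₀₂) (proj₂ p₀₂)
          (proj₁ (far-sym p₁₃)) (proj₂ (far-sym p₁₃))

        -- The antihole of `UW` for `p` read backwards.
        WU : CompleteTo G U (p 2) → CompleteTo G W (p 1) → Even (3 + k)
        WU cU cW = antihole-four even-antiholes antipath 2≤k
          (U-misses-first in₂ cU) (W-misses-last in₁ cW) c₃ c₀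
          (symm G p₂₃) (symm G p₁₂) (symm G p₀₁)
          (proj₁ (far-sym p₀₃)) (proj₂ (far-sym p₀₃)) (proj₁ (far-sym p₁₃)) (proj₂ (far-sym p₁₃))
          (proj₁ p₀₂) (proj₂ p₀₂)

      -- A vertex complete to `U` occurs at `p 1` or at the last inner position, and likewise for
      -- `W`. The same position is excluded by `not-both`; at opposite ones the two vertices are
      -- adjacent, so `l` is 3 and there is an antihole of odd length `5 + k`.
      absurd : ⊥
      absurd
        with i , i<l , sU ← odd⇒U-step | j , j<l , sW ← odd⇒W-step
        with a , ina , cU ← step-end i<l sU | b , inb , cW ← step-end j<l sW
        with outer-step i<l sU inb (λ inⱼ c → adjacent inⱼ inb c cW)
           | outer-step j<l sW ina (λ inⱼ c → symm G (adjacent ina inⱼ cU c))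
      ... | inj₁ cU₁ | inj₁ cW₁ = not-both (s≤s z≤n , 2≤l) cU₁ cW₁
      ... | inj₂ (_ , refl , inₘ , cU′) | inj₂ (_ , refl , _ , cW′) = not-both inₘ cU′ cW′
      ... | inj₁ cU₁ | inj₂ (m , eq , inₘ , cW′)
            with refl ← length-three eq inₘ (adjacent (s≤s z≤n , 2≤l) inₘ cU₁ cW′) =
            consecutive-parity k k-even (UW eq cU₁ cW′)
      ... | inj₂ (m , eq , inₘ , cU′) | inj₁ cW₁
            with refl ← length-three eq inₘ (symm G (adjacent inₘ (s≤s z≤n , 2≤l) cU′ cW₁)) =
            consecutive-parity k k-even (WU eq cU′ cW₁)

    module OddAntipath (k-odd : ¬ Even k) (c : Core (complement G) xs (R 0) (R k) U W) where
      open Core c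

      -- Together with the apex `v`, an adjacent pair would give an antihole of odd length `4 + k`.
      nonadjacent : ∀ {i j} → Inner i → Inner j → CompleteTo G U (p i) → CompleteTo G W (p j) →
        ¬ Adj G (p i) (p j)
      nonadjacent inᵢ@(0<i , i<l) inⱼ@(0<j , j<l) cU cW e = k-odd
        (antihole-three even-antiholes antipath 2≤k (U-misses-first inᵢ cU) (W-misses-last inⱼ cW)
          (complete⇒joins-all apex-complete) (fresh (<⇒≤ i<l)) (fresh (<⇒≤ j<l))
          (isolated 0<i i<l) (isolated 0<j j<l) e)

      data Kind (i : ℕ) : Set where
        end    : i ≡ 0 ⊎ i ≡ l → CompleteTo G xs (p i) → Kind i
        U-kind : Inner i → CompleteTo G U (p i) → Kind i
        W-kind : Inner i → CompleteTo G W (p i) → Kind i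

      kind : ∀ {i} → i ≤ l → CompleteTo G Z (p i) → Kind i
      kind {zero} _ _ = end (inj₁ refl) first-complete
      kind {suc i} i<l cZ with m≤n⇒m<n∨m≡n i<l
      ... | inj₂ refl = end (inj₂ refl) last-complete
      ... | inj₁ i<l′ with adj? G (p (suc i)) (R 0) | adj? G (p (suc i)) (R k)
      ...   | yes e | _     = W-kind (s≤s z≤n , i<l′) (complete-cover G W-split e cZ)
      ...   | no _  | yes e = U-kind (s≤s z≤n , i<l′) (complete-cover G U-split e cZ)
      -- Missing both `R 0` and `R k`, the vertex closes the antipath to an antihole of odd length
      -- `2 + k`.
      ...   | no ¬e | no ¬e′ = contradiction
        (path-closed-by-vertex antipath even-antiholes 2≤k (off-antipath i<l)
          (off-antipath i<l z≤n , ¬e) (off-antipath i<l ≤-refl , ¬e′)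
          (λ 0<j j<k → adj⇒¬coadj (All.lookup cZ (middle∈Z 0<j j<k))))
        k-odd
        where
        middle∈Z : ∀ {j} → 0 < j → j < k → R j ∈ Z
        middle∈Z 0<j j<k with U-cover (R∈xs (<⇒≤ j<k))
        ... | inj₁ eq = contradiction (sym eq) (distinct antipath 0<j (<⇒≤ j<k))
        ... | inj₂ ∈U with U-split ∈U
        ...   | inj₁ eq = contradiction eq (distinct antipath j<k ≤-refl)
        ...   | inj₂ ∈Z = ∈Z

      -- The ends of `p` are complete to both lists, and inner vertices to at most one, so an inner
      -- end decides. One exists since `l` is not 1, and two of different kinds are ruled out by
      -- `nonadjacent`.
      split-step : ∀ {i} → i < l → CompleteStep G Z p i →
        (CompleteStep G U p i × ¬ CompleteStep G W p i) ⊎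
        (¬ CompleteStep G U p i × CompleteStep G W p i)
      split-step {i} i<l (cᵢ , c₊) with kind (<⇒≤ i<l) cᵢ | kind i<l c₊
      ... | end (inj₂ refl) _ | _ = contradiction i<l (<-irrefl refl)
      ... | end (inj₁ refl) _ | end (inj₂ 1≡l) _ = contradiction (sym 1≡l) l≢1
      ... | end (inj₁ refl) x | U-kind in₊ y =
            inj₁ ((restrict G U⊆xs x , y) , not-both in₊ y ∘ proj₂)
      ... | end (inj₁ refl) x | W-kind in₊ y =
            inj₂ ((λ (_ , y′) → not-both in₊ y′ y) , restrict G W⊆xs x , y)
      ... | U-kind inᵢ x | end _ y = inj₁ ((x , restrict G U⊆xs y) , not-both inᵢ x ∘ proj₁)
      ... | W-kind inᵢ x | end _ y = inj₂ ((λ (x′ , _) → not-both inᵢ x′ x) , x , restrict G W⊆xs y)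
      ... | U-kind inᵢ x | U-kind _ y = inj₁ ((x , y) , not-both inᵢ x ∘ proj₁)
      ... | W-kind inᵢ x | W-kind _ y = inj₂ ((λ (x′ , _) → not-both inᵢ x′ x) , x , y)
      ... | U-kind inᵢ x | W-kind in₊ y =
            contradiction (consecutive path i<l) (nonadjacent inᵢ in₊ x y)
      ... | W-kind inᵢ x | U-kind in₊ y =
            contradiction (symm G (consecutive path i<l)) (nonadjacent in₊ inᵢ y x)

      tally-split : ∀ {i} → i < l → indicator (completeStep? G Z p i) ≡
        indicator (completeStep? G U p i) + indicator (completeStep? G W p i)
      tally-split {i} i<l = indicator-+
        (completeStep? G Z p i) (completeStep? G U p i) (completeStep? G W p i)
        (split-step i<l)
        (λ (x , y) → restrict G Z⊆U x , restrict G Z⊆U y)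
        (λ (x , y) → restrict G Z⊆W x , restrict G Z⊆W y)

      -- Each edge counted for `Z` is counted for exactly one of `U` and `W`, so `l` has the parity
      -- of `l + l`.
      absurd : ⊥
      absurd = l-odd (begin
        parity l
          ≡⟨ edge Z-grown Z-shorter (restrict-probe (U⊆xs ∘ Z⊆U) pr) ⟨
        parity (tally (completeStep? G Z p) l)
          ≡⟨ cong parity (trans (∑-cong l tally-split) (∑-+ _ _ l)) ⟩
        parity (tally (completeStep? G U p) l + tally (completeStep? G W p) l)
          ≡⟨ parity-+ (tally (completeStep? G U p) l) l (tally (completeStep? G W p) l) l
               (edge U-grown U-shorter (restrict-probe U⊆xs pr))
                              (edge W-grown W-shorter (restrict-probe W⊆xs pr)) ⟩
        parity (l + l)
          ≡⟨ even-n+n l ⟩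
        parity 0
          ∎)
        where open ≡-Reasoning

    pair-absurd : ⊥
    pair-absurd with even? k
    ... | yes k-even = EvenAntipath.absurd k-even
    ... | no k-odd   = [ (λ k-even → k-odd k-even) , OddAntipath.absurd k-odd ]′ core

  -- Gap parity in Berge graphs

  module _ (berge : Berge G) where

    -- Strong induction on the length of the list, as `U`, `W` and `Z` are shorter. For a stable
    -- list an odd length would give a complete edge, and since `l` is not 1, one end of it would be
    -- inner.
    gap-parity : ∀ {xs} → Acc _<_ (length xs) → Grown (complement G) xs → GapParity G xs
    gap-parity {xs} (acc rec) grown {p} {l} pr incomplete with l ≟ 1 | even? l
    ... | yes l≡1 | _         = inj₁ l≡1
    ... | _       | yes even  = inj₂ even
    ... | no l≢1  | no l-odd with clique-or-pair grown
    ...   | inj₂ pair = ⊥-elim (pair-absurd (proj₂ berge) pair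
              (λ ys-grown shorter → gap⇒edge (gap-parity (rec shorter) ys-grown))
              pr incomplete l≢1 l-odd)
    gap-parity {x ∷ xs} (acc rec) grown {p} {l} pr incomplete | no l≢1 | no l-odd | inj₁ stable
      with i , i<l , s ← odd⇒complete-step (stable-edge-parity (proj₁ berge) stable) pr l-odd =
      ⊥-elim (step-absurd i<l s)
      where
      step-absurd : ∀ {i} → i < l → ¬ CompleteStep G (x ∷ xs) p i
      step-absurd {zero}  0<l (_ , c) = incomplete (s≤s z≤n) (≤∧≢⇒< 0<l (l≢1 ∘ sym)) c
      step-absurd {suc i} i<l (c , _) = incomplete (s≤s z≤n) i<l c

-- Subsets and counting

module _ {n : ℕ} (H : Graph n) (X : Subset n) where
  open DecMembership (_≟ᶠ_ {n}) using () renaming (_∈?_ to _∈ˡ?_)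

  -- Vertices of the walk not yet listed are added one by one, each being adjacent to its
  -- predecessor, which is already in the list.
  grow-along : ∀ {u w ys} → Star (λ a b → a ∈ˢ X × b ∈ˢ X × Adj H a b) u w →
    Grown H ys → u ∈ ys → (∀ {z} → z ∈ ys → z ∈ˢ X) →
    ∃ λ zs → Grown H zs × w ∈ zs × ys ⊆ zs × (∀ {z} → z ∈ zs → z ∈ˢ X)
  grow-along {ys = ys} ε grown u∈ ys⊆X = ys , grown , u∈ , id , ys⊆X
  grow-along {ys = ys} (_◅_ {j = b} (_ , b∈X , ub) walk) grown u∈ ys⊆X with b ∈ˡ? ys
  ... | yes b∈ = grow-along walk grown b∈ ys⊆X
  ... | no b∉
    with zs , zs-grown , w∈ , ⊆zs , zs⊆X ←
         grow-along walk (grow b∉ (lose u∈ (symm H ub)) grown) (here refl)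
           (λ { (here refl) → b∈X ; (there z∈) → ys⊆X z∈ }) =
    zs , zs-grown , w∈ , ⊆zs ∘ there , zs⊆X

  -- Each vertex of `us` in `X` is reached by a walk from the root `r`; with `us` running through
  -- all vertices this exhausts `X`.
  grow-over : ConnectedOn H X → ∀ {r ys} → Grown H ys → r ∈ ys → (∀ {z} → z ∈ ys → z ∈ˢ X) →
    ∀ us → ∃ λ zs → Grown H zs × r ∈ zs × (∀ {z} → z ∈ zs → z ∈ˢ X) ×
      (∀ {z} → z ∈ us → z ∈ˢ X → z ∈ zs)
  grow-over conn {ys = ys} grown r∈ ys⊆X [] = ys , grown , r∈ , ys⊆X , λ ()
  grow-over conn grown r∈ ys⊆X (u ∷ us)
    with zs , zs-grown , r∈zs , zs⊆X , covers ← grow-over conn grown r∈ ys⊆X us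
    with u ∈? X
  ... | no u∉X = zs , zs-grown , r∈zs , zs⊆X ,
    λ { (here refl) u∈X → contradiction u∈X u∉X ; (there z∈) → covers z∈ }
  ... | yes u∈X
    with vs , vs-grown , u∈vs , ⊆vs , vs⊆X ←
         grow-along (conn (zs⊆X r∈zs) u∈X) zs-grown r∈zs zs⊆X =
    vs , vs-grown , ⊆vs r∈zs , vs⊆X ,
    λ { (here refl) _ → u∈vs ; (there z∈) z∈X → ⊆vs (covers z∈ z∈X) }

  connected⇒grown : Nonempty X → ConnectedOn H X →
    ∃ λ xs → Grown H xs × (∀ {z} → z ∈ xs → z ∈ˢ X) × (∀ {z} → z ∈ˢ X → z ∈ xs)
  connected⇒grown (r , r∈X) conn
    with zs , zs-grown , _ , zs⊆X , covers ←
         grow-over conn (single r) (here refl) (λ { (here refl) → r∈X }) (allFin n) =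
    zs , zs-grown , zs⊆X , covers (∈-allFin _)

x∉p-x : ∀ {m} (p : Subset m) x → x ∉ˢ p - x
x∉p-x (_ ∷ p) (suc x) (there x∈) = x∉p-x p x x∈

-- `q` is left arbitrary so that the induction can pass to tails; the case of interest is
-- `q = p - x`.
∣p∣≤1+∣q∣ : ∀ {m} (p q : Subset m) x → (∀ {z} → z ∈ˢ p → z ≢ x → z ∈ˢ q) → ∣ p ∣ ≤ suc ∣ q ∣
∣p∣≤1+∣q∣ (s ∷ p) (t ∷ q) zero p-x⊆q = begin
  ∣ s ∷ p ∣      ≤⟨ ∣s∷p∣≤ s ⟩
  suc ∣ p ∣      ≤⟨ s≤s (p⊆q⇒∣p∣≤∣q∣ λ z∈ → drop-there (p-x⊆q (there z∈) λ ())) ⟩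
  suc ∣ q ∣      ≤⟨ s≤s (∣p∣≤∣x∷p∣ t q) ⟩
  suc ∣ t ∷ q ∣  ∎
  where
  open ≤-Reasoning
  ∣s∷p∣≤ : ∀ s → ∣ s ∷ p ∣ ≤ suc ∣ p ∣
  ∣s∷p∣≤ inside  = ≤-refl
  ∣s∷p∣≤ outside = n≤1+n _
∣p∣≤1+∣q∣ (inside ∷ p) (inside ∷ q) (suc x) p-x⊆q =
  s≤s (∣p∣≤1+∣q∣ p q x λ z∈ z≢x → drop-there (p-x⊆q (there z∈) (z≢x ∘ suc-injectiveᶠ)))
∣p∣≤1+∣q∣ (inside ∷ p) (outside ∷ q) (suc x) p-x⊆q = contradiction (p-x⊆q here λ ()) λ ()
∣p∣≤1+∣q∣ (outside ∷ p) (t ∷ q) (suc x) p-x⊆q = ≤-trans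
  (∣p∣≤1+∣q∣ p q x λ z∈ z≢x → drop-there (p-x⊆q (there z∈) (z≢x ∘ suc-injectiveᶠ)))
  (s≤s (∣p∣≤∣x∷p∣ t q))

∣p∣≤1+∣p-x∣ : ∀ {m} (p : Subset m) x → ∣ p ∣ ≤ suc ∣ p - x ∣
∣p∣≤1+∣p-x∣ p x = ∣p∣≤1+∣q∣ p (p - x) x x∈p∧x≢y⇒x∈p-y

0<∣p∣⇒nonempty : ∀ {m} (p : Subset m) → 0 < ∣ p ∣ → Nonempty p
0<∣p∣⇒nonempty {m} p 0<∣p∣ with nonempty? p
... | yes ne = ne
... | no ¬ne = contradiction (trans (cong ∣_∣ (Empty-unique ¬ne)) (∣⊥∣≡0 m)) (>⇒≢ 0<∣p∣)

module _ {m : ℕ} {P : Pred (Fin m) 0ℓ} (P? : Decidable P) where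
  private
    S : Subset m
    S = tabulate (does ∘ P?)

  P⇒∈ : ∀ {i} → P i → i ∈ˢ S
  P⇒∈ {i} p = lookup⇒[]= i S (trans (lookup∘tabulate (does ∘ P?) i) (dec-true (P? i) p))

  ∈⇒P : ∀ {i} → i ∈ˢ S → P i
  ∈⇒P {i} i∈ with P? i | trans (sym (lookup∘tabulate (does ∘ P?) i)) ([]=⇒lookup i∈)
  ... | yes p | _ = p

  -- Deleting `a` and `b`, which may coincide, costs at most two positions.
  another : 3 ≤ count P? → ∀ a b → ∃ λ k → P k × k ≢ a × k ≢ b
  another 3≤ a b with k , k∈ ← 0<∣p∣⇒nonempty (S - a - b)
      (s≤s⁻¹ (s≤s⁻¹ (≤-trans 3≤ (≤-trans (∣p∣≤1+∣p-x∣ S a) (s≤s (∣p∣≤1+∣p-x∣ (S - a) b))))))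
    = k , ∈⇒P (p─q⊆p S _ k∈S-a) , (λ { refl → x∉p-x S a k∈S-a }) , λ { refl → x∉p-x (S - a) b k∈ }
    where k∈S-a = p─q⊆p (S - a) _ k∈

  two≤count : ∀ {i j} → P i → P j → i ≢ j → 2 ≤ count P?
  two≤count pi pj i≢j = ≤-trans (s≤s (≤-trans (s≤s z≤n) (x∈p⇒∣p-x∣<∣p∣
    (x∈p∧x≢y⇒x∈p-y (P⇒∈ pj) (i≢j ∘ sym))))) (x∈p⇒∣p-x∣<∣p∣ (P⇒∈ pi))

  three≤count : ∀ {i j k} → P i → P j → P k → i ≢ j → i ≢ k → j ≢ k → 3 ≤ count P?
  three≤count pi pj pk i≢j i≢k j≢k = ≤-trans (s≤s (≤-trans (s≤s (≤-trans (s≤s z≤n)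
      (x∈p⇒∣p-x∣<∣p∣ (x∈p∧x≢y⇒x∈p-y (x∈p∧x≢y⇒x∈p-y (P⇒∈ pk) (i≢k ∘ sym)) (j≢k ∘ sym)))))
      (x∈p⇒∣p-x∣<∣p∣ (x∈p∧x≢y⇒x∈p-y (P⇒∈ pj) (i≢j ∘ sym)))))
    (x∈p⇒∣p-x∣<∣p∣ (P⇒∈ pi))

-- Paths and holes listed by Fin

∑-split : ∀ f a b → ∑ f (a + b) ≡ ∑ f a + ∑ (segment a f) b
∑-split f a zero rewrite +-identityʳ a = sym (+-identityʳ (∑ f a))
∑-split f a (suc b) rewrite +-suc a b | ∑-split f a b = +-assoc (∑ f a) _ _

∑-single : ∀ {f} n {a} → a < n → (∀ {i} → i ≢ a → f i ≡ 0) → ∑ f n ≡ f a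
∑-single {f} (suc n) {a} a<1+n zeros with m≤n⇒m<n∨m≡n (s≤s⁻¹ a<1+n)
... | inj₁ a<n  = trans (cong₂ _+_ (∑-single n a<n zeros) (zeros (≢-sym (<⇒≢ a<n)))) (+-identityʳ _)
... | inj₂ refl = cong (_+ f a) (∑-zero n (zeros ∘ <⇒≢))

-- The sum of the first `a + m` terms is split after `a` and after `m` terms; by periodicity the
-- last `a` terms repeat the first ones.
∑-rotate : ∀ f a m → (∀ i → f (m + i) ≡ f i) → ∑ (segment a f) m ≡ ∑ f m
∑-rotate f a m periodic = +-cancelˡ-≡ (∑ f a) _ _ (begin
  ∑ f a + ∑ (segment a f) m  ≡⟨ ∑-split f a m ⟨
  ∑ f (a + m)                ≡⟨ cong (∑ f) (+-comm a m) ⟩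
  ∑ f (m + a)                ≡⟨ ∑-split f m a ⟩
  ∑ f m + ∑ (segment m f) a  ≡⟨ cong (∑ f m +_) (∑-cong a (λ {i} _ → periodic i)) ⟩
  ∑ f m + ∑ f a              ≡⟨ +-comm (∑ f m) (∑ f a) ⟩
  ∑ f a + ∑ f m              ∎)
  where open ≡-Reasoning

sum-tabulate : ∀ {m} (h : Fin m → ℕ) (f : ℕ → ℕ) → (∀ i → h i ≡ f (toℕ i)) →
  sum (tabulate h) ≡ ∑ f m
sum-tabulate {zero}  h f h≗f = refl
sum-tabulate {suc m} h f h≗f = trans
  (cong₂ _+_ (h≗f zero) (sum-tabulate (h ∘ suc) (f ∘ suc) (h≗f ∘ suc)))
  (sym (∑-split f 1 m))

count-tabulate : ∀ {m} {P : Pred (Fin m) 0ℓ} (P? : Decidable P) (f : ℕ → ℕ) →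
  (∀ i → indicator (P? i) ≡ f (toℕ i)) → count P? ≡ ∑ f m
count-tabulate {m} P? f eq = trans (go P?) (sum-tabulate (indicator ∘ P?) f eq)
  where
  go : ∀ {m} {P : Pred (Fin m) 0ℓ} (P? : Decidable P) → count P? ≡ sum (tabulate (indicator ∘ P?))
  go {zero}  P? = refl
  go {suc m} P? with does (P? zero)
  ... | true  = cong suc (go (P? ∘ suc))
  ... | false = go (P? ∘ suc)

-- The oriented half of `CycleAdj`: the successor with wraparound.
Next : ∀ {m} → Fin m → Fin m → Set
Next i j = suc (toℕ i) ≡ toℕ j ⊎ LastFirst i j

module _ {m : ℕ} where

  next-functional : ∀ {i j k : Fin m} → Next i j → Next i k → j ≡ k
  next-functional (inj₁ p) (inj₁ q) = toℕ-injective (trans (sym p) q)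
  next-functional {j = j} (inj₁ p) (inj₂ (q , _)) = contradiction (trans (sym p) q) (<⇒≢ (toℕ<n j))
  next-functional {k = k} (inj₂ (p , _)) (inj₁ q) = contradiction (trans (sym q) p) (<⇒≢ (toℕ<n k))
  next-functional (inj₂ (_ , p)) (inj₂ (_ , q)) = toℕ-injective (trans p (sym q))

  next-injective : ∀ {i j k : Fin m} → Next j i → Next k i → j ≡ k
  next-injective (inj₁ p) (inj₁ q) = toℕ-injective (suc-injective (trans p (sym q)))
  next-injective (inj₁ p) (inj₂ (_ , q)) = contradiction (trans p q) λ ()
  next-injective (inj₂ (_ , p)) (inj₁ q) = contradiction (trans q p) λ ()
  next-injective (inj₂ (p , _)) (inj₂ (q , _)) = toℕ-injective (suc-injective (trans p (sym q)))

  cycle⇒next : ∀ {i j : Fin m} → CycleAdj i j → Next i j ⊎ Next j i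
  cycle⇒next (inj₁ (inj₁ p)) = inj₁ (inj₁ p)
  cycle⇒next (inj₁ (inj₂ p)) = inj₂ (inj₁ p)
  cycle⇒next (inj₂ (inj₁ p)) = inj₁ (inj₂ p)
  cycle⇒next (inj₂ (inj₂ p)) = inj₂ (inj₂ p)

  next⇒cycle : ∀ {i j : Fin m} → Next i j → CycleAdj i j
  next⇒cycle (inj₁ p) = inj₁ (inj₁ p)
  next⇒cycle (inj₂ p) = inj₂ (inj₁ p)

  -- Of three neighbours two are successors or two are predecessors, and either kind is unique.
  cycle-degree≤2 : ∀ {i a b c : Fin m} → CycleAdj i a → CycleAdj i b → CycleAdj i c →
    a ≢ b → a ≢ c → b ≢ c → ⊥
  cycle-degree≤2 x y z a≢b a≢c b≢c with cycle⇒next x | cycle⇒next y | cycle⇒next z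
  ... | inj₁ p | inj₁ q | _      = a≢b (next-functional p q)
  ... | inj₁ p | inj₂ _ | inj₁ r = a≢c (next-functional p r)
  ... | inj₁ _ | inj₂ q | inj₂ r = b≢c (next-injective q r)
  ... | inj₂ _ | inj₁ q | inj₁ r = b≢c (next-functional q r)
  ... | inj₂ p | inj₁ _ | inj₂ r = a≢c (next-injective p r)
  ... | inj₂ p | inj₂ q | _      = a≢b (next-injective p q)

module _ {l : ℕ} where
  private
    m = suc l

  toℕ-mod : ∀ x → toℕ (x mod m) ≡ x % m
  toℕ-mod x = toℕ-fromℕ< (m%n<n x m)

  toℕ-mod-< : ∀ {x} → x < m → toℕ (x mod m) ≡ x
  toℕ-mod-< {x} x<m = trans (toℕ-mod x) (m<n⇒m%n≡m x<m)

  mod-toℕ : ∀ (i : Fin m) → toℕ i mod m ≡ i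
  mod-toℕ i = toℕ-injective (toℕ-mod-< (toℕ<n i))

  mod-period : ∀ x → (x + m) mod m ≡ x mod m
  mod-period x = toℕ-injective
    (trans (toℕ-mod (x + m)) (trans ([m+n]%n≡m%n x m) (sym (toℕ-mod x))))

  mod-injective : ∀ {x y} → x ≤ y → y < x + m → x mod m ≡ y mod m → x ≡ y
  mod-injective {x} {y} x≤y y<x+m eq with e , refl ← m≤n⇒∃[o]m+o≡n x≤y = go e m∣e (+-cancelˡ-< x e m y<x+m)
    where
    x%m≡ : x % m ≡ (x + e) % m
    x%m≡ = trans (sym (toℕ-mod x)) (trans (cong toℕ eq) (toℕ-mod (x + e)))

    quotients : x / m * m + e ≡ (x + e) / m * m
    quotients = +-cancelˡ-≡ (x % m) _ _ (begin
      x % m + (x / m * m + e)              ≡⟨ +-assoc (x % m) (x / m * m) e ⟨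
      x % m + x / m * m + e                ≡⟨ cong (_+ e) (m≡m%n+[m/n]*n x m) ⟨
      x + e                                ≡⟨ m≡m%n+[m/n]*n (x + e) m ⟩
      (x + e) % m + (x + e) / m * m        ≡⟨ cong (_+ (x + e) / m * m) x%m≡ ⟨
      x % m + (x + e) / m * m              ∎)
      where open ≡-Reasoning

    m∣e : m ∣ e
    m∣e = ∣m+n∣m⇒∣n (subst (m ∣_) (sym quotients) (n∣m*n ((x + e) / m))) (n∣m*n (x / m))

    go : ∀ e → m ∣ e → e < m → x ≡ x + e
    go zero    _   _   = sym (+-identityʳ x)
    go (suc e) m∣e e<m = contradiction m∣e (>⇒∤ e<m)

  suc-% : ∀ x → suc x % m ≡ suc (x % m) % m
  suc-% x = begin
    suc x % m                        ≡⟨ cong (λ k → suc k % m) (m≡m%n+[m/n]*n x m) ⟩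
    (suc (x % m) + x / m * m) % m    ≡⟨ [m+kn]%n≡m%n (suc (x % m)) (x / m) m ⟩
    suc (x % m) % m                  ∎
    where open ≡-Reasoning

  next-mod : ∀ x → Next (x mod m) (suc x mod m)
  next-mod x with m≤n⇒m<n∨m≡n (m%n<n x m)
  ... | inj₁ below = inj₁ (trans (cong suc (toℕ-mod x))
          (sym (trans (toℕ-mod (suc x)) (trans (suc-% x) (m<n⇒m%n≡m below)))))
  ... | inj₂ wraps = inj₂ (trans (cong suc (toℕ-mod x)) wraps ,
          trans (toℕ-mod (suc x)) (trans (suc-% x) (trans (%-congˡ {o = m} wraps) (n%n≡0 m))))

  -- Moving the start one place on shortens the distance by one, except that distance 0 becomes `l`,
  -- a full turn less one step.
  reach : ∀ a (k : Fin m) → ∃ λ t → t < m × (a + t) mod m ≡ k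
  reach zero    k = toℕ k , toℕ<n k , mod-toℕ k
  reach (suc a) k with reach a k
  ... | suc t , t<m , eq = t , <⇒≤ t<m , trans (cong (_mod m) (sym (+-suc a t))) eq
  ... | zero  , _   , eq = l , ≤-refl , (begin
    (suc a + l) mod m  ≡⟨ cong (_mod m) (+-suc a l) ⟨
    (a + m) mod m      ≡⟨ mod-period a ⟩
    a mod m            ≡⟨ cong (_mod m) (+-identityʳ a) ⟨
    (a + 0) mod m      ≡⟨ eq ⟩
    k                  ∎)
    where open ≡-Reasoning

-- Indices wrap around, so that every arc of a hole, from any starting point, is a segment of one
-- sequence.
unroll : ∀ {A : Set} {l} → (Fin (suc l) → A) → ℕ → A
unroll {l = l} f i = f (i mod suc l)

module _ {n : ℕ} {G : Graph n} {l : ℕ} where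

  unroll-path : ∀ {q : Fin (suc l) → Fin n} → IsPath G q → Path G (unroll q) l
  unroll-path {q} (_ , q-injective , q-induces) = record
    { distinct = λ {i} {j} i<j j≤l eq → <⇒≢ i<j (begin
        i                    ≡⟨ toℕ-mod-< (<-trans i<j (s≤s j≤l)) ⟨
        toℕ (i mod suc l)    ≡⟨ cong toℕ (q-injective eq) ⟩
        toℕ (j mod suc l)    ≡⟨ toℕ-mod-< (s≤s j≤l) ⟩
        j                    ∎)
    ; consecutive = λ {i} i<l → Equivalence.to (q-induces (i mod suc l) (suc i mod suc l))
        (inj₁ (trans (cong suc (toℕ-mod-< (m<n⇒m<1+n i<l))) (sym (toℕ-mod-< (s≤s i<l)))))
    ; chordless = λ {i} {j} i<j j≤l e →
        [ (λ eq → trans (cong suc (sym (toℕ-mod-< (<-trans i<j (s≤s j≤l)))))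
                        (trans eq (toℕ-mod-< (s≤s j≤l))))
        , (λ eq → contradiction
            (trans (cong suc (sym (toℕ-mod-< (s≤s j≤l))))
                   (trans eq (toℕ-mod-< (<-trans i<j (s≤s j≤l)))))
            (≢-sym (<⇒≢ (m<n⇒m<1+n i<j))))
        ]′ (Equivalence.from (q-induces (i mod suc l) (j mod suc l)) e)
    }
    where open ≡-Reasoning

  -- The `suc d` vertices of the arc leave out at least one of the `suc l` vertices of the hole, so
  -- the ends are not joined around the back.
  arc-path : ∀ {c : Fin (suc l) → Fin n} → IsHole G c → ∀ a {d} → suc d ≤ l →
    Path G (segment a (unroll c)) d
  arc-path {c} (_ , c-injective , c-induces) a {d} d<l = record
    { distinct = λ {i} {j} i<j j≤d eq → <⇒≢ i<j (+-cancelˡ-≡ a _ _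
        (mod-injective (+-monoʳ-≤ a (<⇒≤ i<j))
          (close (≤-trans (s≤s j≤d) (≤-trans (m≤n⇒m≤1+n d<l) (m≤n+m (suc l) i))))
          (c-injective eq)))
    ; consecutive = λ {i} _ → subst (λ x → Adj G (c ((a + i) mod suc l)) (c (x mod suc l)))
        (sym (+-suc a i)) (Equivalence.to (c-induces _ _) (next⇒cycle (next-mod (a + i))))
    ; chordless = chordless-arc
    }
    where
    close : ∀ {i j} → suc j ≤ i + suc l → a + j < a + i + suc l
    close {i} {j} j<i+m = subst (a + j <_) (sym (+-assoc a i (suc l))) (+-monoʳ-< a j<i+m)

    chordless-arc : ∀ {i j} → i < j → j ≤ d →
      Adj G (c ((a + i) mod suc l)) (c ((a + j) mod suc l)) → suc i ≡ j
    chordless-arc {i} {j} i<j j≤d e with cycle⇒next (Equivalence.from (c-induces _ _) e)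
    ... | inj₁ next = +-cancelˡ-≡ a _ _ (trans (+-suc a i)
          (mod-injective (+-monoʳ-< a i<j)
            (m<n⇒m<1+n (close {i} {j} (≤-trans (s≤s j≤d) (≤-trans (m≤n⇒m≤1+n d<l) (m≤n+m (suc l) i)))))
            (next-functional (next-mod (a + i)) next)))
    ... | inj₂ next = contradiction
          (mod-injective (m≤n⇒m≤1+n (+-monoʳ-≤ a (<⇒≤ i<j)))
            (subst (_< a + i + suc l) (+-suc a j)
              (close {i} {suc j} (≤-trans (s≤s (s≤s j≤d)) (≤-trans (s≤s d<l) (m≤n+m (suc l) i)))))
            (next-functional next (next-mod (a + j))))
          (<⇒≢ (s≤s (+-monoʳ-≤ a (<⇒≤ i<j))))

module _ {n : ℕ} {G : Graph n} {m : ℕ} {f : Fin m → Fin n} where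

  host-injective : IsPath G f ⊎ IsHole G f → ∀ {i j} → f i ≡ f j → i ≡ j
  host-injective (inj₁ (_ , inj , _)) = inj
  host-injective (inj₂ (_ , inj , _)) = inj

  -- A path is treated as part of a cycle, so that the degree bound covers both kinds of host.
  host-cycle : IsPath G f ⊎ IsHole G f → ∀ {i j} → Adj G (f i) (f j) → CycleAdj i j
  host-cycle (inj₁ (_ , _ , induces)) e = inj₁ (Equivalence.from (induces _ _) e)
  host-cycle (inj₂ (_ , _ , induces)) e = Equivalence.from (induces _ _) e

-- Gaps on a path or hole

module _ {n : ℕ} (G : Graph n) (berge : Berge G) (X : Subset n)
         (nonempty : Nonempty X) (anticonnected : Anticonnected G X) where

  -- The apex is a complete vertex `f k` distinct from both ends; being complete, it is not inner
  -- either. An inner vertex adjacent to it would have three neighbours in the host.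
  host-gap : ∀ {m} {f : Fin m → Fin n} → IsPath G f ⊎ IsHole G f → f Avoids X →
    3 ≤ #completeVertices G X f → ∀ {p d} → Path G p d → (∀ {i} → i ≤ d → ∃ λ a → p i ≡ f a) →
    Complete G X (p 0) → Complete G X (p d) →
    (∀ {i} → 0 < i → i < d → ¬ Complete G X (p i)) → d ≡ 1 ⊎ Even d
  host-gap {f = f} host avoids 3≤ {p} {d} path on-host c₀ c incomplete
    with xs , grown , xs⊆X , X⊆xs ← connected⇒grown (complement G) X nonempty anticonnected
    with a , p₀≡ ← on-host {0} z≤n | b , p_d≡ ← on-host {d} ≤-refl
    with k , cₖ , k≢a , k≢b ← another (λ i → complete? G X (f i)) 3≤ a b =
    gap-parity berge (<-wellFounded (length xs)) grown probe
      (λ 0<i i<d c → incomplete 0<i i<d λ x x∈X → All.lookup c (X⊆xs x∈X))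
    where
    to-xs : ∀ {u} → Complete G X u → CompleteTo G xs u
    to-xs c = All.tabulate λ z∈ → c _ (xs⊆X z∈)

    fresh : ∀ {i} → i ≤ d → f k ≢ p i
    fresh {zero} _ eq = k≢a (host-injective {G = G} host (trans eq p₀≡))
    fresh {suc i} i<d eq with m≤n⇒m<n∨m≡n i<d
    ... | inj₁ i<d′ = incomplete (s≤s z≤n) i<d′ (subst (Complete G X) eq cₖ)
    ... | inj₂ refl = k≢b (host-injective {G = G} host (trans eq p_d≡))

    isolated : ∀ {i} → 0 < i → i < d → ¬ Adj G (f k) (p i)
    isolated {suc i} _ i<d e
      with x , p≡x ← on-host (<⇒≤ (<-trans (n<1+n i) i<d)) | y , p≡y ← on-host (<⇒≤ i<d)
         | z , p≡z ← on-host i<d =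
      cycle-degree≤2
        (host-cycle {G = G} host {y} {k} (subst (λ u → Adj G u (f k)) p≡y (symm G e)))
        (host-cycle {G = G} host {y} {x} (subst₂ (Adj G) p≡y p≡x
          (symm G (consecutive path (<-trans (n<1+n i) i<d)))))
        (host-cycle {G = G} host {y} {z} (subst₂ (Adj G) p≡y p≡z (consecutive path i<d)))
        (λ k≡x → fresh (<⇒≤ (<-trans (n<1+n i) i<d)) (trans (cong f k≡x) (sym p≡x)))
        (λ k≡z → fresh i<d (trans (cong f k≡z) (sym p≡z)))
        (λ x≡z → distinct path (<-trans (n<1+n i) (n<1+n (suc i))) i<d
          (trans p≡x (trans (cong f x≡z) (sym p≡z))))

    probe : Probe G xs p d (f k)
    probe = record
      { path = path
      ; avoids = λ i≤d ∈xs → let a , eq = on-host i≤d in avoids a (xs⊆X (subst (_∈ xs) eq ∈xs))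
      ; fresh = fresh ; isolated = isolated
      ; apex-complete = to-xs cₖ ; first-complete = to-xs c₀ ; last-complete = to-xs c
      }

-- Complete edges as steps along the listing

module _ {n : ℕ} (G : Graph n) (X : Subset n) {l : ℕ} (f : Fin (suc l) → Fin n) where
  private
    F = unroll f

    unroll-toℕ : ∀ i → F (toℕ i) ≡ f i
    unroll-toℕ i = cong f (mod-toℕ i)

  edgeStep? : ∀ i → Dec (CompleteEdge G X (F i) (F (suc i)))
  edgeStep? i = completeEdge? G X (F i) (F (suc i))

  -- The edge between the first and last vertices. For `l = 1` it is already a step, hence the bound
  -- `2 ≤ l`.
  closing? : Dec (2 ≤ l × CompleteEdge G X (F 0) (F l))
  closing? = (2 ≤? l) ×-dec completeEdge? G X (F 0) (F l)

  -- Adjacent positions `i < j` are consecutive or the first and the last. The double count splits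
  -- accordingly into `near?` and `far?`, with at most one entry of either kind in a row.
  #completeEdges≡tally : (∀ {i j} → toℕ i < toℕ j → Adj G (f i) (f j) → CycleAdj i j) →
    #completeEdges G X f ≡ tally edgeStep? l + indicator closing?
  #completeEdges≡tally cyclic = begin
    #completeEdges G X f
      ≡⟨ sum-tabulate _ (λ a → ∑ (cell a) (suc l)) (λ i → count-tabulate (edge? i) (cell (toℕ i)) (split i)) ⟩
    ∑ (λ a → ∑ (cell a) (suc l)) (suc l)
      ≡⟨ ∑-cong (suc l) (λ {a} _ → ∑-+ (indicator ∘ near? a) (indicator ∘ far? a) (suc l)) ⟩
    ∑ (λ a → ∑ (indicator ∘ near? a) (suc l) + ∑ (indicator ∘ far? a) (suc l)) (suc l)
      ≡⟨ ∑-+ (λ a → ∑ (indicator ∘ near? a) (suc l)) (λ a → ∑ (indicator ∘ far? a) (suc l)) (suc l) ⟩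
    ∑ (λ a → ∑ (indicator ∘ near? a) (suc l)) (suc l) + ∑ (λ a → ∑ (indicator ∘ far? a) (suc l)) (suc l)
      ≡⟨ cong₂ _+_ near-total far-total ⟩
    tally edgeStep? l + indicator closing?
      ∎
    where
    open ≡-Reasoning

    Near : ℕ → ℕ → Set
    Near a b = suc a ≡ b × CompleteEdge G X (F a) (F b)

    Far : ℕ → ℕ → Set
    Far a b = (a ≡ 0 × b ≡ l) × 2 ≤ l × CompleteEdge G X (F 0) (F l)

    near? : ∀ a b → Dec (Near a b)
    near? a b = (suc a ≟ b) ×-dec completeEdge? G X (F a) (F b)

    far? : ∀ a b → Dec (Far a b)
    far? a b = ((a ≟ 0) ×-dec (b ≟ l)) ×-dec closing?

    cell : ℕ → ℕ → ℕ
    cell a b = indicator (near? a b) + indicator (far? a b)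

    edge-unroll : ∀ {i j} → CompleteEdge G X (f i) (f j) → CompleteEdge G X (F (toℕ i)) (F (toℕ j))
    edge-unroll {i} {j} = subst₂ (CompleteEdge G X) (sym (unroll-toℕ i)) (sym (unroll-toℕ j))

    edge-roll : ∀ {i j} → CompleteEdge G X (F (toℕ i)) (F (toℕ j)) → CompleteEdge G X (f i) (f j)
    edge-roll {i} {j} = subst₂ (CompleteEdge G X) (unroll-toℕ i) (unroll-toℕ j)

    edge? : ∀ i j → Dec (toℕ i < toℕ j × CompleteEdge G X (f i) (f j))
    edge? i j = (toℕ i <? toℕ j) ×-dec completeEdge? G X (f i) (f j)

    split : ∀ i j → indicator (edge? i j) ≡ cell (toℕ i) (toℕ j)
    split i j = indicator-+ (edge? i j) (near? (toℕ i) (toℕ j)) (far? (toℕ i) (toℕ j)) classify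
      (λ (eq , e) → ≤-reflexive eq , edge-roll e)
      (λ ((i≡0 , j≡l) , 2≤l , e) →
        subst₂ _<_ (sym i≡0) (sym j≡l) (≤-trans (s≤s z≤n) 2≤l) ,
        edge-roll (subst₂ (λ a b → CompleteEdge G X (F a) (F b)) (sym i≡0) (sym j≡l) e))
      where
      classify : toℕ i < toℕ j × CompleteEdge G X (f i) (f j) →
        (Near (toℕ i) (toℕ j) × ¬ Far (toℕ i) (toℕ j)) ⊎
        (¬ Near (toℕ i) (toℕ j) × Far (toℕ i) (toℕ j))
      classify (i<j , e) with suc (toℕ i) ≟ toℕ j
      ... | yes eq = inj₁ ((eq , edge-unroll e) ,
            λ ((i≡0 , j≡l) , 2≤l , _) → <⇒≢ 2≤l (trans (cong suc (sym i≡0)) (trans eq j≡l)))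
      ... | no ≢ with cyclic i<j (proj₁ e)
      ...   | inj₁ (inj₁ eq) = contradiction eq ≢
      ...   | inj₁ (inj₂ eq) = contradiction (≤-reflexive eq) (<-asym i<j)
      ...   | inj₂ (inj₁ (_ , j≡0)) = contradiction (subst (toℕ i <_) j≡0 i<j) λ ()
      ...   | inj₂ (inj₂ (1+j≡1+l , i≡0)) = inj₂ (≢ ∘ proj₁ , (i≡0 , j≡l) ,
              subst₂ (λ a b → 2+ a ≤ b) i≡0 j≡l (≤∧≢⇒< i<j ≢) ,
              subst₂ (λ a b → CompleteEdge G X (F a) (F b)) i≡0 j≡l (edge-unroll e))
              where j≡l = suc-injective 1+j≡1+l

    near-total : ∑ (λ a → ∑ (indicator ∘ near? a) (suc l)) (suc l) ≡ tally edgeStep? l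
    near-total = trans (cong₂ _+_
      (∑-cong l λ {a} a<l → trans
        (∑-single (suc l) (s≤s a<l) λ {b} b≢ → indicator-no (near? a b) (b≢ ∘ sym ∘ proj₁))
        (indicator-cong (near? a (suc a)) (edgeStep? a) proj₂ (refl ,_)))
      -- Row `l` contributes nothing, as its successor is out of range.
      (∑-zero (suc l) λ {b} b<1+l → indicator-no (near? l b) (≢-sym (<⇒≢ b<1+l) ∘ proj₁)))
      (+-identityʳ _)

    far-total : ∑ (λ a → ∑ (indicator ∘ far? a) (suc l)) (suc l) ≡ indicator closing?
    far-total = trans
      (∑-single (suc l) {0} (s≤s z≤n) λ {a} a≢0 →
        ∑-zero (suc l) λ {b} _ → indicator-no (far? a b) (a≢0 ∘ proj₁ ∘ proj₁))
      (trans (∑-single (suc l) {l} ≤-refl λ {b} b≢l → indicator-no (far? 0 b) (b≢l ∘ proj₂ ∘ proj₁))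
        (indicator-cong (far? 0 l) closing? proj₂ ((refl , refl) ,_)))

-- Edge parity on subpaths and on holes

module _ {n : ℕ} (G : Graph n) (berge : Berge G) (X : Subset n)
         (nonempty : Nonempty X) (anticonnected : Anticonnected G X) where

  -- The closing edge would be a chord of `q`; what remains is a tally whose gaps are controlled by
  -- the host `p`.
  path-edge-parity : ∀ {m} {p : Fin m → Fin n} → IsPath G p ⊎ IsHole G p → p Avoids X →
    3 ≤ #completeVertices G X p → ∀ {l} {q : Fin (suc l) → Fin n} → IsPath G q → q ⊑ p →
    Complete G X (q zero) → Complete G X (q (fromℕ l)) →
    parity (#completeEdges G X q) ≡ parity l
  path-edge-parity {p = p} host avoids 3≤ {l} {q} isPath q⊑p c₀ c = begin
    parity (#completeEdges G X q)
      ≡⟨ cong parity (#completeEdges≡tally G X q λ _ e →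
           inj₁ (Equivalence.from (proj₂ (proj₂ isPath) _ _) e)) ⟩
    parity (tally (edgeStep? G X q) l + indicator (closing? G X q))
      ≡⟨ cong (λ k → parity (tally (edgeStep? G X q) l + k)) (indicator-no (closing? G X q) λ (2≤l , e , _) →
           <⇒≢ 2≤l (chordless path (≤-trans (s≤s z≤n) 2≤l) ≤-refl e)) ⟩
    parity (tally (edgeStep? G X q) l + 0)
      ≡⟨ cong parity (+-identityʳ (tally (edgeStep? G X q) l)) ⟩
    parity (tally (edgeStep? G X q) l)
      ≡⟨ parity-tally (complete? G X ∘ Q) (edgeStep? G X q) l (λ _ → proj₂) gaps
           c₀ (subst (Complete G X ∘ q) last c) ⟩
    parity l
      ∎
    where
    open ≡-Reasoning
    Q = unroll q
    path = unroll-path isPath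

    last : fromℕ l ≡ l mod suc l
    last = toℕ-injective (trans (toℕ-fromℕ l) (sym (toℕ-mod-< ≤-refl)))

    gaps : ∀ {i d} → 0 < d → i + d ≤ l → Complete G X (Q i) → Complete G X (Q (i + d)) →
      (∀ {k} → 0 < k → k < d → ¬ Complete G X (Q (i + k))) →
      (d ≡ 1 × CompleteEdge G X (Q i) (Q (suc i))) ⊎ Even d
    gaps {i} {d} _ i+d≤l cᵢ c incomplete
      with host-gap G berge X nonempty anticonnected host avoids 3≤ (segment-path path i+d≤l)
             (λ _ → q⊑p _) (subst (Complete G X ∘ Q) (sym (+-identityʳ i)) cᵢ) c incomplete
    ... | inj₂ even = inj₂ even
    ... | inj₁ refl = inj₁ (refl , consecutive path (≤-trans (≤-reflexive (+-comm 1 i)) i+d≤l) , cᵢ ,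
                        subst (Complete G X ∘ Q) (+-comm i 1) c)

  module _ {l : ℕ} {c : Fin (suc l) → Fin n} (isHole : IsHole G c) where
    private
      C = unroll c

    hole-consecutive : ∀ i → Adj G (C i) (C (suc i))
    hole-consecutive i = Equivalence.to (proj₂ (proj₂ isHole) _ _) (next⇒cycle (next-mod i))

    C-period : ∀ i → C (i + suc l) ≡ C i
    C-period i = cong c (mod-period i)

    -- By periodicity the closing edge of a hole is the step from `l` to `suc l`.
    hole-#completeEdges : #completeEdges G X c ≡ tally (edgeStep? G X c) (suc l)
    hole-#completeEdges = trans
      (#completeEdges≡tally G X c λ _ e → Equivalence.from (proj₂ (proj₂ isHole) _ _) e)
      (cong (tally (edgeStep? G X c) l +_) (indicator-cong (closing? G X c) (edgeStep? G X c l)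
        (λ (_ , e , c₀ , cₗ) → hole-consecutive l , cₗ , subst (Complete G X) (sym (C-period 0)) c₀)
        (λ (_ , cₗ , c₊) → ≤-trans (s≤s (s≤s z≤n)) (s≤s⁻¹ (proj₁ isHole)) ,
          subst (λ u → Adj G u (C l)) (C-period 0) (symm G (hole-consecutive l)) ,
          subst (Complete G X) (C-period 0) c₊ , cₗ)))

    -- A third complete vertex, at distance `t` from the start of the gap, is neither an end of the
    -- gap nor inner. Hence `d < t ≤ l`, and the arc is short enough to be an induced path.
    short : ∀ a {i d k} t → t < suc l → (a + i + t) mod suc l ≡ k → Complete G X (c k) →
      k ≢ (a + i) mod suc l → k ≢ (a + i + d) mod suc l →
      (∀ {j} → 0 < j → j < d → ¬ Complete G X (C (a + (i + j)))) → suc d ≤ l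
    short a {i} zero _ eq _ k≢i _ _ =
      contradiction (trans (sym eq) (cong (_mod suc l) (+-identityʳ (a + i)))) k≢i
    short a {i} {d} (suc t) t<m eq cₖ _ k≢i+d incomplete with <-cmp (suc t) d
    ... | tri< t<d _ _ = contradiction
          (subst (Complete G X ∘ C) (+-assoc a i (suc t)) (subst (Complete G X ∘ c) (sym eq) cₖ))
          (incomplete (s≤s z≤n) t<d)
    ... | tri≈ _ refl _ = contradiction (sym eq) k≢i+d
    ... | tri> _ _ d<t = ≤-trans d<t (s≤s⁻¹ t<m)

    hole-gap : c Avoids X → 3 ≤ #completeVertices G X c → ∀ a {i d} →
      Complete G X (C (a + i)) → Complete G X (C (a + (i + d))) →
      (∀ {k} → 0 < k → k < d → ¬ Complete G X (C (a + (i + k)))) →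
      (d ≡ 1 × CompleteEdge G X (C (a + i)) (C (suc (a + i)))) ⊎ Even d
    hole-gap avoids 3≤ a {i} {d} cᵢ c₊ incomplete =
      let k , cₖ , k≢i , k≢i+d = another (λ i → complete? G X (c i)) 3≤
            ((a + i) mod suc l) ((a + i + d) mod suc l)
          t , t<m , eq = reach (a + i) k
      in Sum.map₁ single-edge
        (host-gap G berge X nonempty anticonnected (inj₂ isHole) avoids 3≤
          (arc-path isHole (a + i) (short a t t<m eq cₖ k≢i k≢i+d incomplete)) (λ _ → _ , refl)
          (subst (Complete G X ∘ C) (sym (+-identityʳ (a + i))) cᵢ)
          (subst (Complete G X ∘ C) (sym (+-assoc a i d)) c₊)
          (λ 0<k k<d → incomplete 0<k k<d ∘ subst (Complete G X ∘ C) (+-assoc a i _)))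
      where
      single-edge : d ≡ 1 → d ≡ 1 × CompleteEdge G X (C (a + i)) (C (suc (a + i)))
      single-edge refl = refl , hole-consecutive (a + i) , cᵢ ,
        subst (Complete G X ∘ C) (trans (sym (+-assoc a i 1)) (+-comm (a + i) 1)) c₊

    -- One full turn from a complete vertex back to itself is scanned; its length `suc l` is even
    -- because the graph is Berge.
    hole-edge-parity-from : c Avoids X → 3 ≤ #completeVertices G X c → ∀ a → Complete G X (C a) →
      Even (#completeEdges G X c)
    hole-edge-parity-from avoids 3≤ a cₐ = begin
      parity (#completeEdges G X c)
        ≡⟨ cong parity hole-#completeEdges ⟩
      parity (tally (edgeStep? G X c) (suc l))
        ≡⟨ cong parity (∑-rotate (indicator ∘ edgeStep? G X c) a (suc l) periodic) ⟨
      parity (tally (edgeStep? G X c ∘ (a +_)) (suc l))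
        ≡⟨ parity-tally (complete? G X ∘ C ∘ (a +_)) (edgeStep? G X c ∘ (a +_)) (suc l)
             (λ {i} _ (_ , x , y) → x , subst (Complete G X ∘ C) (sym (+-suc a i)) y)
             (λ {i} {d} _ _ → hole-gap avoids 3≤ a {i} {d}) (subst (Complete G X ∘ C) (sym (+-identityʳ a)) cₐ)
             (subst (Complete G X) (sym (C-period a)) cₐ) ⟩
      parity (suc l)
        ≡⟨ proj₁ berge c isHole ⟩
      parity 0
        ∎
      where
      open ≡-Reasoning

      periodic : ∀ i → indicator (edgeStep? G X c (suc l + i)) ≡ indicator (edgeStep? G X c i)
      periodic i = cong₂ (λ u w → indicator (completeEdge? G X u w)) (shift i)
        (trans (cong C (sym (+-suc (suc l) i))) (shift (suc i)))
        where
        shift : ∀ i → C (suc l + i) ≡ C i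
        shift i = trans (cong C (+-comm (suc l) i)) (C-period i)

    hole-edge-parity : c Avoids X → 3 ≤ #completeVertices G X c → Even (#completeEdges G X c)
    hole-edge-parity avoids 3≤ =
      let k , cₖ , _ = another (λ i → complete? G X (c i)) 3≤ zero zero
      in hole-edge-parity-from avoids 3≤ (toℕ k) (subst (Complete G X ∘ c) (sym (mod-toℕ k)) cₖ)

    -- Without a complete edge the count is 0. Otherwise the two ends of such an edge are all the
    -- complete vertices, as there are fewer than three.
    hole-few-complete : ¬ 3 ≤ #completeVertices G X c →
      Even (#completeEdges G X c) ⊎
      (#completeVertices G X c ≡ 2 ×
       (∀ i j → i ≢ j → Complete G X (c i) → Complete G X (c j) → Adj G (c i) (c j)))
    hole-few-complete ≱3 with anyUpTo? (edgeStep? G X c) (suc l)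
    ... | no none = inj₁ (cong parity (trans hole-#completeEdges
            (∑-zero (suc l) λ {i} i<m → indicator-no (edgeStep? G X c i) λ e → none (i , i<m , e))))
    ... | yes (i , _ , e , cᵢ , cᵢ₊₁) = inj₂
            (≤-antisym (s≤s⁻¹ (≰⇒> ≱3)) (two≤count P? cᵢ cᵢ₊₁ a≢b) , adjacent)
      where
      P? = λ i → complete? G X (c i)
      a = i mod suc l
      b = suc i mod suc l

      a≢b : a ≢ b
      a≢b a≡b = irrefl G (cong c a≡b) e

      one-of : ∀ {j} → Complete G X (c j) → j ≡ a ⊎ j ≡ b
      one-of {j} cⱼ with j ≟ᶠ a | j ≟ᶠ b
      ... | yes j≡a | _       = inj₁ j≡a
      ... | no _    | yes j≡b = inj₂ j≡b
      ... | no j≢a  | no j≢b  = contradiction (three≤count P? cⱼ cᵢ cᵢ₊₁ j≢a j≢b a≢b) ≱3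

      adjacent : ∀ i j → i ≢ j → Complete G X (c i) → Complete G X (c j) → Adj G (c i) (c j)
      adjacent i j i≢j cᵢ cⱼ with one-of cᵢ | one-of cⱼ
      ... | inj₁ refl | inj₁ refl = contradiction refl i≢j
      ... | inj₁ refl | inj₂ refl = e
      ... | inj₂ refl | inj₁ refl = symm G e
      ... | inj₂ refl | inj₂ refl = contradiction refl i≢j

theorem2p3 : ∀ {n : ℕ} (G : Graph n) → Berge G →
    ∀ (X : Subset n) → Nonempty X → Anticonnected G X →
    (∀ {m : ℕ} (p : Fin m → Fin n) → IsPath G p ⊎ IsHole G p → p Avoids X →
    3 ≤ #completeVertices G X p →
    ∀ {l : ℕ} (q : Fin (suc l) → Fin n) → IsPath G q → q ⊑ p →
    Complete G X (q zero) → Complete G X (q (fromℕ l)) →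
    parity (#completeEdges G X q) ≡ parity l)
    ×
    (∀ {m : ℕ} (c : Fin m → Fin n) → IsHole G c → c Avoids X →
    Even (#completeEdges G X c)
    ⊎
    (#completeVertices G X c ≡ 2
    × (∀ i j → i ≢ j → Complete G X (c i) → Complete G X (c j) → Adj G (c i) (c j))))
theorem2p3 {n} G berge X nonempty anticonnected =
  (λ p host avoids 3≤ q → path-edge-parity G berge X nonempty anticonnected host avoids 3≤) , hole
  where
  hole : ∀ {m : ℕ} (c : Fin m → Fin n) → IsHole G c → c Avoids X →
    Even (#completeEdges G X c) ⊎
    (#completeVertices G X c ≡ 2 ×
     (∀ i j → i ≢ j → Complete G X (c i) → Complete G X (c j) → Adj G (c i) (c j)))
  hole {zero}  c (() , _) avoids
  hole {suc l} c isHole avoids with 3 ≤? #completeVertices G X c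
  ... | yes 3≤ = inj₁ (hole-edge-parity G berge X nonempty anticonnected isHole avoids 3≤)
  ... | no ≱3  = hole-few-complete G berge X nonempty anticonnected isHole ≱3
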